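{- Let $k\geq 1$ be an integer and let $G$ be a non-bipartite $k$-extendable graph with $\nu(G)=4k$ vertices and minimum degree $\delta(G)$. Then: (1) if $\delta(G)\geq 3k$, then $G$ is $2k$-factor-critical; (2) if $\delta(G)=2k$, then $G$ is not $2k$-factor-critical; (3) if $2k+1\leq \delta(G)\leq 3k-1$, then $G$ is not $2k$-factor-critical if and only if there exists a partition of $V(G)$ into two sets $V_1$ and $V_2$ with $|V_1|=|V_2|=2k$ such that each of the induced subgraphs $G[V_1]$ and $G[V_2]$ consists of exactly two components, each of which is factor-critical and has at least $3$ vertices.
   Context: All graphs are undirected, simple, finite and connected. $\nu(G)$ is the number of vertices and $\delta(G)$ the minimum degree of $G$. A connected graph $G$ is $k$-extendable (for $0\leq k\leq (\nu(G)-2)/2$) if it contains a matching of size $k$ and every matching of size $k$ in $G$ is contained in a perfect matching of $G$. A graph $G$ is $n$-factor-critical (for $0\leq n\leq \nu(G)-2$) if $G-S$ has a perfect matching for every $S\subseteq V(G)$ with $|S|=n$. A graph $H$ is factor-critical if $H-v$ has a perfect matching for every vertex $v$ of $H$. -}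

module Defs where

open import Data.Nat using (ℕ; zero; suc; _+_; _*_; _≤_; _<_)
open import Data.Bool using (Bool; true; false; if_then_else_)
open import Data.Fin using (Fin; toℕ)
open import Data.Fin.Subset using (Subset; _∈_; _∉_; ∣_∣; ⊤; ∁; _∩_; _∪_; ⊥; _-_)
open import Data.List using (List; map; allFin)
open import Data.Nat.ListAction using (sum)
open import Data.Maybe using (Maybe; just; nothing)
open import Data.Product using (Σ; ∃; _×_; _,_)
open import Relation.Binary.PropositionalEquality using (_≡_)
open import Relation.Nullary using (¬_)

record Graph (n : ℕ) : Set where
  field
    adj    : Fin n → Fin n → Bool
    sym    : ∀ u v → adj u v ≡ adj v u
    irrefl : ∀ v → adj v v ≡ false

module _ {n : ℕ} (G : Graph n) where
  open Graph G

  Edge : Fin n → Fin n → Set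
  Edge u v = adj u v ≡ true

  data ReachIn (U : Subset n) : Fin n → Fin n → Set where
    here : ∀ {v} → v ∈ U → ReachIn U v v
    step : ∀ {u w v} → u ∈ U → Edge u w → ReachIn U w v → ReachIn U u v

  ConnectedIn : Subset n → Set
  ConnectedIn U = ∀ u v → u ∈ U → v ∈ U → ReachIn U u v

  Connected : Set
  Connected = ConnectedIn ⊤

  degree : Fin n → ℕ
  degree v = sum (map (λ w → if adj v w then 1 else 0) (allFin n))

  MinDegree : ℕ → Set
  MinDegree d = (∀ v → d ≤ degree v) × ∃ λ v → degree v ≡ d

  Bipartite : Set
  Bipartite = ∃ λ (c : Fin n → Bool) → ∀ u v → Edge u v → ¬ (c u ≡ c v)

  record MatchingIn (U : Subset n) : Set where
    field
      mate     : Fin n → Maybe (Fin n)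
      mateEdge : ∀ v w → mate v ≡ just w → Edge v w
      mateSym  : ∀ v w → mate v ≡ just w → mate w ≡ just v
      mateIn   : ∀ v w → mate v ≡ just w → v ∈ U

  Matching : Set
  Matching = MatchingIn ⊤

  lowerEnd : Fin n → Maybe (Fin n) → ℕ
  lowerEnd v nothing = 0
  lowerEnd v (just w) with toℕ v Data.Nat.<? toℕ w
  ... | Relation.Nullary.yes _ = 1
  ... | Relation.Nullary.no _ = 0

  size : ∀ {U} → MatchingIn U → ℕ
  size M = sum (map (λ v → lowerEnd v (MatchingIn.mate M v)) (allFin n))

  PerfectIn : ∀ {U} → MatchingIn U → Set
  PerfectIn {U} M = ∀ v → v ∈ U → ∃ λ w → MatchingIn.mate M v ≡ just w

  HasPerfectMatchingIn : Subset n → Set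
  HasPerfectMatchingIn U = Σ (MatchingIn U) PerfectIn

  _⊆M_ : ∀ {U V} → MatchingIn U → MatchingIn V → Set
  M ⊆M M' = ∀ v w → MatchingIn.mate M v ≡ just w → MatchingIn.mate M' v ≡ just w

  Extendable : ℕ → Set
  Extendable k = Connected
               × (∃ λ (M : Matching) → size M ≡ k)
               × (∀ (M : Matching) → size M ≡ k →
                    ∃ λ (M' : Matching) → PerfectIn M' × M ⊆M M')

  FactorCritical : ℕ → Set
  FactorCritical m = ∀ (S : Subset n) → ∣ S ∣ ≡ m → HasPerfectMatchingIn (∁ S)

  FactorCriticalIn : Subset n → Set
  FactorCriticalIn C = ∀ v → v ∈ C → HasPerfectMatchingIn (C - v)

  TwoFCComponents : Subset n → Set
  TwoFCComponents U =
    ∃ λ (C₁ : Subset n) → ∃ λ (C₂ : Subset n) →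
      (C₁ ∪ C₂ ≡ U) × (C₁ ∩ C₂ ≡ ⊥)
      × ConnectedIn C₁ × ConnectedIn C₂
      × (∀ u v → u ∈ C₁ → v ∈ C₂ → ¬ Edge u v)
      × (3 ≤ ∣ C₁ ∣) × (3 ≤ ∣ C₂ ∣)
      × FactorCriticalIn C₁ × FactorCriticalIn C₂

{-# OPTIONS --safe #-}
module Submission where

-- Call a set of 2k vertices bad if it has no perfect matching.  By k-extendability the complement
-- of a bad set is bad.  If G is not 2k-factor-critical, some set is bad, and exchanging one vertex
-- at a time on the way to a set spanned by a k-matching yields a bad T whose
-- maximum matchings miss exactly two vertices; the same then holds for W = V ∖ T.  Let D(T) be the
-- set of vertices missed by some maximum matching of T.  Extending a maximum matching of T and one
-- edge tw with t ∈ D(T), w ∈ W shows w ∈ D(W).  Counting the degrees of two vertices missed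
-- together makes D(T) and D(W) so large that every vertex of T ∖ D(T) has a neighbour in D(T);
-- then T ∖ D(T) is independent, by Gallai's exchange argument.  Since δ > 2k, a vertex of T ∖ D(T)
-- forces |D(W)| < |D(T)|, and symmetrically, which leaves D(T) = T and D(W) = W.  By Gallai's lemma
-- T and W then both consist of two factor-critical components.

open import Defs
open import Data.Bool using (Bool; true; false; if_then_else_)
open import Data.Empty using (⊥; ⊥-elim)
open import Data.Fin using (Fin; toℕ; _≟_)
open import Data.Fin.Properties using (any?; toℕ-injective)
open import Data.Fin.Subset using (Subset; ∣_∣; ∁; _─_; _-_; ⁅_⁆)
  renaming (_∈_ to _∈ₛ_; _∉_ to _∉ₛ_)
open import Data.Fin.Subset.Properties using (anySubset?; ∈⊤; x∈p∪q⁻; x∈p∪q⁺; x∈p∩q⁻; ∣∁p∣≡n∸∣p∣;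
  Empty-unique; ⊆-antisym; p─q⊆p; x∈⁅x⁆; x∈p∧x≢y⇒x∈p-y; x∉p⇒x∈∁p; x∈∁p⇒x∉p)
  renaming (_∈?_ to _∈ₛ?_)
open import Data.List as List using (List; []; _∷_; [_]; _++_; map; length; filter; allFin; lookup; removeAt)
open import Data.List.Membership.Propositional using (_∈_; _∉_)
open import Data.List.Membership.Propositional.Properties
  using (∈-∃++; ∈-++⁺ˡ; ∈-++⁺ʳ; ∈-++⁻; ∈-filter⁺; ∈-filter⁻; ∈-allFin)
open import Data.List.Membership.Propositional.Properties.WithK using (unique∧set⇒bag)
open import Data.List.Properties
  using (map-++; map-tabulate; filter-accept; filter-reject; length-++; length-tabulate)
open import Data.List.Relation.Binary.BagAndSetEquality using (∼bag⇒↭)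
open import Data.List.Relation.Binary.Permutation.Propositional
  using (_↭_; prep; swap; ↭-refl; ↭-sym; ↭-trans; ↭⇒↭ₛ)
open import Data.List.Relation.Binary.Permutation.Propositional.Properties
  using (∈-resp-↭; map⁺; ↭-empty-inv; ↭-length; ++⁺; ++⁺ˡ; ++⁺ʳ; ++-comm; shift; drop-∷; filter-↭;
         ++-commutativeMonoid)
import Data.List.Relation.Binary.Permutation.Setoid.Properties as PermutationSetoid
open import Data.List.Relation.Unary.All as All using ()
open import Data.List.Relation.Unary.AllPairs using ([]; _∷_)
open import Data.List.Relation.Unary.Any using (here; there; index)
open import Data.List.Relation.Unary.Any.Properties using (lookup-index)
open import Data.List.Relation.Unary.Unique.Propositional using (Unique)
open import Data.List.Relation.Unary.Unique.Propositional.Properties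
  using (allFin⁺; filter⁺) renaming (Unique[x∷xs]⇒x∉xs to Unique-head)
open import Data.Maybe using (Maybe; just; nothing)
open import Data.Maybe.Properties using (just-injective)
open import Data.Nat using (ℕ; zero; suc; _+_; _*_; _∸_; _≤_; _<_; _<?_; z≤n; s≤s)
open import Data.Nat.ListAction using (sum)
open import Data.Nat.ListAction.Properties using (sum-++; sum-↭)
import Data.Nat.Properties as ℕ
open import Data.Nat.Tactic.RingSolver using (solve-∀)
open import Data.Product using (∃; ∃₂; _×_; _,_; proj₁; proj₂)
open import Data.Sum using (_⊎_; inj₁; inj₂)
open import Data.Vec as Vec using (_∷_)
open import Data.Vec.Properties using (lookup∘tabulate; tabulate∘lookup; []=⇒lookup; lookup⇒[]=)
open import Function using (_∘_)
open import Function.Bundles using (_⇔_; mk⇔)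
open import Relation.Binary.PropositionalEquality
  using (_≡_; _≢_; refl; sym; trans; cong; cong₂; subst; subst₂; setoid; module ≡-Reasoning)
open import Relation.Nullary using (¬_; Dec; yes; no; does; ¬?; _×-dec_)
open import Relation.Nullary.Decidable using (map′; decidable-stable; dec-true)
open import Relation.Unary using (Decidable)

-- Lists up to permutation, and sums over lists

module _ {A : Set} where
  open import Algebra.Solver.CommutativeMonoid (++-commutativeMonoid {A = A}) public
    using (solve; _⊕_; _⊜_)

  ∈⇒↭ : ∀ {x : A} {xs} → x ∈ xs → ∃ λ ys → xs ↭ x ∷ ys
  ∈⇒↭ {x} p with ys , zs , refl ← ∈-∃++ p = ys ++ zs , shift x ys zs

  ↭⇒∈ : ∀ {x : A} {xs ys} → xs ↭ x ∷ ys → x ∈ xs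
  ↭⇒∈ p = ∈-resp-↭ (↭-sym p) (here refl)

  -- Two splits of one multiset cut it into four blocks: `C` is common to `T` and `X`, `S` is what
  -- `T` gives up and `R` what it receives in order to become `X`.
  common-refinement : ∀ {T W X Y : List A} → T ++ W ↭ X ++ Y →
    ∃₂ λ C S → ∃₂ λ R Z → T ↭ C ++ S × W ↭ R ++ Z × X ↭ C ++ R × Y ↭ S ++ Z
  common-refinement {[]} {W} {X} {Y} p = [] , [] , X , Y , ↭-refl , p , ↭-refl , ↭-refl
  common-refinement {t ∷ T} {W} {X} {Y} p with ∈-++⁻ X (∈-resp-↭ p (here refl))
  ... | inj₁ t∈X with X′ , q ← ∈⇒↭ t∈X
      with C , S , R , Z , a , b , c , d ←
        common-refinement {T} {W} {X′} {Y} (drop-∷ (↭-trans p (++⁺ʳ Y q)))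
      = t ∷ C , S , R , Z , prep t a , b , ↭-trans q (prep t c) , d
  ... | inj₂ t∈Y with Y′ , q ← ∈⇒↭ t∈Y
      with C , S , R , Z , a , b , c , d ←
        common-refinement {T} {W} {X} {Y′} (drop-∷ (↭-trans p (↭-trans (++⁺ˡ X q) (shift t X Y′))))
      = C , t ∷ S , R , Z , ↭-trans (prep t a) (↭-sym (shift t C S)) , b , c , ↭-trans q (prep t d)

  filter-complement : ∀ {P : A → Set} (P? : Decidable P) L →
    filter P? L ++ filter (¬? ∘ P?) L ↭ L
  filter-complement P? [] = ↭-refl
  filter-complement P? (x ∷ L) with P? x
  ... | yes _ = prep x (filter-complement P? L)
  ... | no  _ = ↭-trans (shift x (filter P? L) _) (prep x (filter-complement P? L))

  ↭-removeAt : ∀ (L : List A) i → L ↭ lookup L i ∷ removeAt L i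
  ↭-removeAt (x ∷ L) Fin.zero = ↭-refl
  ↭-removeAt (x ∷ L) (Fin.suc i) = ↭-trans (prep x (↭-removeAt L i)) (swap x _ ↭-refl)

  sumOver : List A → (A → ℕ) → ℕ
  sumOver L f = sum (map f L)

  sumOver-↭ : ∀ {L M} f → L ↭ M → sumOver L f ≡ sumOver M f
  sumOver-↭ f p = sum-↭ (map⁺ f p)

  sumOver-++ : ∀ L M f → sumOver (L ++ M) f ≡ sumOver L f + sumOver M f
  sumOver-++ L M f = trans (cong sum (map-++ f L M)) (sum-++ (map f L) (map f M))

  sumOver-+ : ∀ L f g → sumOver L (λ x → f x + g x) ≡ sumOver L f + sumOver L g
  sumOver-+ [] f g = refl
  sumOver-+ (x ∷ L) f g = trans (cong (f x + g x +_) (sumOver-+ L f g))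
    (interchange (f x) (g x) (sumOver L f) (sumOver L g))
    where open import Algebra.Properties.CommutativeSemigroup ℕ.+-commutativeSemigroup

  sumOver-mono : ∀ L {f g} → (∀ {x} → x ∈ L → f x ≤ g x) → sumOver L f ≤ sumOver L g
  sumOver-mono [] h = z≤n
  sumOver-mono (x ∷ L) h = ℕ.+-mono-≤ (h (here refl)) (sumOver-mono L (h ∘ there))

  sumOver-cong : ∀ L {f g} → (∀ {x} → x ∈ L → f x ≡ g x) → sumOver L f ≡ sumOver L g
  sumOver-cong [] h = refl
  sumOver-cong (x ∷ L) h = cong₂ _+_ (h (here refl)) (sumOver-cong L (h ∘ there))

  sumOver-1 : ∀ L → sumOver L (λ _ → 1) ≡ length L
  sumOver-1 [] = refl
  sumOver-1 (x ∷ L) = cong suc (sumOver-1 L)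

  sumOver-0 : ∀ L → sumOver L (λ _ → 0) ≡ 0
  sumOver-0 [] = refl
  sumOver-0 (x ∷ L) = sumOver-0 L

  sumOver-≤-length : ∀ L {f} → (∀ {x} → x ∈ L → f x ≤ 1) → sumOver L f ≤ length L
  sumOver-≤-length L h = ℕ.≤-trans (sumOver-mono L h) (ℕ.≤-reflexive (sumOver-1 L))

-- Matchable sets of vertices

module _ {n : ℕ} (G : Graph n) where
  open Graph G renaming (sym to adj-sym)

  private
    V : Set
    V = Fin n

  Edge? : ∀ u v → Dec (Edge G u v)
  Edge? u v = adj u v Data.Bool.≟ true

  Edge-sym : ∀ {u v} → Edge G u v → Edge G v u
  Edge-sym {u} {v} e = trans (adj-sym v u) e

  Edge-irrefl : ∀ {u v} → Edge G u v → u ≢ v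
  Edge-irrefl {u} e refl with () ← trans (sym e) (irrefl u)

  -- Sets of vertices are represented by lists up to permutation.
  data Matchable : List V → Set where
    empty : Matchable []
    pair  : ∀ {u v L X} → Edge G u v → Matchable L → X ↭ u ∷ v ∷ L → Matchable X

  Matchable-resp-↭ : ∀ {X Y} → X ↭ Y → Matchable X → Matchable Y
  Matchable-resp-↭ p empty rewrite ↭-empty-inv (↭-sym p) = empty
  Matchable-resp-↭ p (pair e m q) = pair e m (↭-trans (↭-sym p) q)

  -- The edge at `u` is added at some stage; the edges added around it commute with it, so it can be
  -- taken as the outermost one.
  partner : ∀ {X u} → Matchable X → u ∈ X →
    ∃₂ λ v L → Edge G u v × Matchable L × X ↭ u ∷ v ∷ L
  partner (pair {a} {b} {L} e m p) u∈X with ∈-resp-↭ p u∈X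
  ... | here refl = b , L , e , m , p
  ... | there (here refl) = a , L , Edge-sym e , m , ↭-trans p (swap a b ↭-refl)
  ... | there (there u∈L) with v , L′ , e′ , m′ , q ← partner m u∈L =
    v , a ∷ b ∷ L′ , e′ , pair e m′ ↭-refl ,
    ↭-trans p (↭-trans (prep a (prep b q))
      (solve 5 (λ a b u v l → a ⊕ b ⊕ u ⊕ v ⊕ l ⊜ u ⊕ v ⊕ a ⊕ b ⊕ l) ↭-refl
        [ a ] [ b ] [ _ ] [ v ] L′))

  Matchable-even : ∀ {X} → Matchable X → ∃ λ j → length X ≡ j + j
  Matchable-even empty = 0 , refl
  Matchable-even (pair e m p) with j , eq ← Matchable-even m =
    suc j , trans (↭-length p) (trans (cong (suc ∘ suc) eq) (cong suc (sym (ℕ.+-suc j j))))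

  -- No edge of the matching joins `P` to its complement, so each edge survives whole or disappears
  -- whole. Matchings are restricted to components in this way.
  Matchable-filter : ∀ {P : V → Set} (P? : Decidable P) {X} → Matchable X →
    (∀ {u v} → u ∈ X → v ∈ X → Edge G u v → P u → P v) → Matchable (filter P? X)
  Matchable-filter P? empty h = empty
  Matchable-filter P? {X} (pair {u} {v} {L} e m p) h =
    Matchable-resp-↭ (↭-sym (filter-↭ P? p)) go
    where
    in-X : ∀ {w} → w ∈ u ∷ v ∷ L → w ∈ X
    in-X = ∈-resp-↭ (↭-sym p)
    rest : Matchable (filter P? L)
    rest = Matchable-filter P? m λ a b → h (in-X (there (there a))) (in-X (there (there b)))
    u∈X = in-X (here refl)
    v∈X = in-X (there (here refl))
    go : Matchable (filter P? (u ∷ v ∷ L))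
    go with P? u
    go | yes pu with P? v
    ... | yes _ = pair e rest ↭-refl
    ... | no ¬pv = ⊥-elim (¬pv (h u∈X v∈X e pu))
    go | no ¬pu with P? v
    ... | yes pv = ⊥-elim (¬pu (h v∈X u∈X (Edge-sym e) pv))
    ... | no _ = rest

  -- Keeping `k` edges of a perfect matching supplies the matchable set towards which vertices are
  -- exchanged later.
  Matchable-prefix : ∀ {X} → Matchable X → ∀ k → k + k ≤ length X →
    ∃₂ λ Y Z → X ↭ Y ++ Z × length Y ≡ k + k × Matchable Y
  Matchable-prefix {X} m zero _ = [] , X , ↭-refl , refl , empty
  Matchable-prefix (pair {u} {v} {L} e m p) (suc k) le
    with Y , Z , q , eq , m′ ← Matchable-prefix m k
           (ℕ.≤-pred (ℕ.≤-pred (subst₂ _≤_ (cong suc (ℕ.+-suc k k)) (↭-length p) le)))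
    = u ∷ v ∷ Y , Z , ↭-trans p (prep u (prep v q)) ,
      trans (cong (suc ∘ suc) eq) (cong suc (sym (ℕ.+-suc k k))) , pair e m′ ↭-refl

  Matchable? : Decidable Matchable
  Matchable? X = go (length X) X ℕ.≤-refl
    where
    -- `f` bounds the length, since `removeAt` is no structural descent. The head must be matched,
    -- so every position of its partner is tried.
    go : ∀ f X → length X ≤ f → Dec (Matchable X)
    go f [] _ = yes empty
    go (suc f) (u ∷ X) (s≤s le) with any? (λ i →
      Edge? u (lookup X i) ×-dec go f (removeAt X i)
        (ℕ.≤-trans (ℕ.n≤1+n _) (subst (_≤ f) (↭-length (↭-removeAt X i)) le)))
    ... | yes (i , e , m) = yes (pair e m (prep u (↭-removeAt X i)))
    ... | no ¬i = no λ m → absurd (partner m (here refl))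
      where
      absurd : ¬ (∃₂ λ v L → Edge G u v × Matchable L × u ∷ X ↭ u ∷ v ∷ L)
      absurd (v , L , e , m , p) = ¬i (i , subst (Edge G u) v≡ e ,
        Matchable-resp-↭ (drop-∷ (↭-trans (↭-sym (drop-∷ p))
          (subst (λ w → X ↭ w ∷ removeAt X i) (sym v≡) (↭-removeAt X i)))) m)
        where
        v∈X = ↭⇒∈ (drop-∷ p)
        i = index v∈X
        v≡ = lookup-index v∈X

-- Matchings that miss two vertices: exchanges and degree bounds

module _ {n : ℕ} where
  open import Data.List.Membership.DecPropositional (_≟_ {n}) public using (_∈?_)

indicator : ∀ {P : Set} → Dec P → ℕ
indicator (yes _) = 1
indicator (no _)  = 0

indicator-≤1 : ∀ {P} (d : Dec P) → indicator d ≤ 1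
indicator-≤1 (yes _) = ℕ.≤-refl
indicator-≤1 (no _)  = z≤n

module _ {n : ℕ} (G : Graph n) where
  open Graph G using (adj; irrefl)

  private
    V : Set
    V = Fin n

  -- A matching missing exactly `a` and `b`. If `T` is unmatchable it is a maximum matching, by
  -- parity; once one exists, `Missable T` is the set D(T) of the Gallai-Edmonds decomposition.
  Pair : List V → V → V → Set
  Pair T a b = ∃ λ L → T ↭ a ∷ b ∷ L × Matchable G L

  Missable : List V → V → Set
  Missable T v = ∃ (Pair T v)

  Pair-sym : ∀ {T a b} → Pair T a b → Pair T b a
  Pair-sym (L , p , m) = L , ↭-trans p (swap _ _ ↭-refl) , m

  Pair⇒¬Edge : ∀ {T a b} → ¬ Matchable G T → Pair T a b → ¬ Edge G a b
  Pair⇒¬Edge ¬T (L , p , m) e = ¬T (pair e m p)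

  Pair? : ∀ T a b → Dec (Pair T a b)
  Pair? T a b with a ∈? T
  ... | no a∉T = no λ (L , p , m) → a∉T (↭⇒∈ p)
  ... | yes a∈T with T′ , q ← ∈⇒↭ a∈T with b ∈? T′
  ... | no b∉T′ = no λ (L , p , m) → b∉T′ (↭⇒∈ (drop-∷ (↭-trans (↭-sym q) p)))
  ... | yes b∈T′ with L , r ← ∈⇒↭ b∈T′ =
    map′ (λ m → L , ↭-trans q (prep a r) , m)
         (λ (L′ , p , m) → Matchable-resp-↭ G
           (drop-∷ (drop-∷ (↭-trans (↭-sym p) (↭-trans q (prep a r))))) m)
         (Matchable? G L)

  Missable? : ∀ T v → Dec (Missable T v)
  Missable? T v = any? (Pair? T v)

  -- The path of the symmetric difference from v is followed two edges at a time.  Q keeps aside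
  -- the ends of edges of the first matching that must survive the exchange.
  exchange : ∀ f {T} Q {t₁ t₂ A v v′ B} → length A ≤ f → ¬ Matchable G T →
    T ↭ Q ++ t₁ ∷ t₂ ∷ A → Matchable G A → T ↭ v ∷ v′ ∷ B → Matchable G B → v ∈ A →
    (∃ λ q → q ∈ Q × Missable T q) ⊎
    (∃ λ t → (t ≡ t₁ ⊎ t ≡ t₂) × ∃ λ L → T ↭ Q ++ v ∷ t ∷ L × Matchable G L)
  exchange zero Q {A = x ∷ A} () _ _ _ _ _ _
  exchange (suc f) {T} Q {t₁} {t₂} {A} {v} {v′} {B} le ¬T pA mA pB mB v∈A
    with p , A′ , e , mA′ , qA ← partner G mA v∈A = main
    where
    -- `T₁` drops `v` and its partner `p` in the first matching. The second matching loses `p` with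
    -- its partner `v₁`, and so misses `v₁` and `v′` in `T₁`.
    T₁ = Q ++ t₁ ∷ t₂ ∷ A′
    T↭ : T ↭ v ∷ p ∷ T₁
    T↭ = ↭-trans pA (↭-trans (++⁺ˡ Q (prep t₁ (prep t₂ qA)))
      (solve 6 (λ q a b v p l → q ⊕ a ⊕ b ⊕ v ⊕ p ⊕ l ⊜ v ⊕ p ⊕ q ⊕ a ⊕ b ⊕ l) ↭-refl
        Q [ t₁ ] [ t₂ ] [ v ] [ p ] A′))
    Goal = (∃ λ q → q ∈ Q × Missable T q) ⊎
           (∃ λ t → (t ≡ t₁ ⊎ t ≡ t₂) × ∃ λ L → T ↭ Q ++ v ∷ t ∷ L × Matchable G L)
    main : Goal
    main with ∈-resp-↭ pB (↭⇒∈ (↭-trans T↭ (swap v p ↭-refl)))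
    ... | here refl = ⊥-elim (Edge-irrefl G e refl)
    -- If `p` is `v′`, the edge from `v` to `p` completes the second matching to one of all of `T`.
    ... | there (here refl) = ⊥-elim (¬T (pair e mB pB))
    ... | there (there p∈B) with v₁ , B′ , e₁ , mB′ , qB ← partner G mB p∈B = next
      where
      T₁↭ : T₁ ↭ v₁ ∷ v′ ∷ B′
      T₁↭ = drop-∷ (drop-∷ (↭-trans (↭-sym T↭) (↭-trans pB (↭-trans (prep v (prep v′ qB))
        (solve 5 (λ v v′ p v₁ l → v ⊕ v′ ⊕ p ⊕ v₁ ⊕ l ⊜ v ⊕ p ⊕ v₁ ⊕ v′ ⊕ l) ↭-refl
          [ v ] [ v′ ] [ p ] [ v₁ ] B′)))))
      lift : ∀ {q} → Missable T₁ q → Missable T q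
      lift {q} (c , L , r , m) = c , v ∷ p ∷ L ,
        ↭-trans T↭ (↭-trans (prep v (prep p r))
          (solve 5 (λ v p q c l → v ⊕ p ⊕ q ⊕ c ⊕ l ⊜ q ⊕ c ⊕ v ⊕ p ⊕ l) ↭-refl
            [ v ] [ p ] [ q ] [ c ] L)) ,
        pair e m ↭-refl
      le′ : length A′ ≤ f
      le′ = ℕ.≤-pred (ℕ.≤-trans (ℕ.n≤1+n _) (subst (_≤ suc f) (↭-length qA) le))
      next : Goal
      next with ∈-++⁻ Q (↭⇒∈ {x = v₁} T₁↭)
      ... | inj₁ v₁∈Q = inj₁ (v₁ , v₁∈Q , lift (v′ , B′ , T₁↭ , mB′))
      -- The path ends at `t₁`: its last edge, from `p` to `t₁`, replaces the one from `v` to `p`,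
      -- which leaves `v` and `t₂` missed.
      ... | inj₂ (here refl) = inj₂ (t₂ , inj₂ refl , p ∷ t₁ ∷ A′ ,
        ↭-trans T↭ (solve 6 (λ q a b v p l → v ⊕ p ⊕ q ⊕ a ⊕ b ⊕ l ⊜ q ⊕ v ⊕ b ⊕ p ⊕ a ⊕ l)
          ↭-refl Q [ t₁ ] [ t₂ ] [ v ] [ p ] A′) ,
        pair e₁ mA′ ↭-refl)
      ... | inj₂ (there (here refl)) = inj₂ (t₁ , inj₁ refl , p ∷ t₂ ∷ A′ ,
        ↭-trans T↭ (solve 6 (λ q a b v p l → v ⊕ p ⊕ q ⊕ a ⊕ b ⊕ l ⊜ q ⊕ v ⊕ a ⊕ p ⊕ b ⊕ l)
          ↭-refl Q [ t₁ ] [ t₂ ] [ v ] [ p ] A′) ,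
        pair e₁ mA′ ↭-refl)
      ... | inj₂ (there (there v₁∈A′))
        with exchange f Q le′ (λ m → ¬T (pair e m T↭)) ↭-refl mA′ T₁↭ mB′ v₁∈A′
      ... | inj₁ (q , q∈Q , mq) = inj₁ (q , q∈Q , lift mq)
      ... | inj₂ (t , t≡ , L , r , m) = inj₂ (t , t≡ , p ∷ v₁ ∷ L ,
        ↭-trans T↭ (↭-trans (prep v (prep p r))
          (solve 6 (λ q v p v₁ t l → v ⊕ p ⊕ q ⊕ v₁ ⊕ t ⊕ l ⊜ q ⊕ v ⊕ t ⊕ p ⊕ v₁ ⊕ l) ↭-refl
            Q [ v ] [ p ] [ v₁ ] [ t ] L)) ,
        pair e₁ m ↭-refl)

  -- Gallai's lemma: not being a pair is a transitive relation between missable vertices.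
  Pair-cotrans : ∀ {T u v w} → ¬ Matchable G T → Pair T u w → Missable T v →
    v ≢ u → v ≢ w → Pair T u v ⊎ Pair T v w
  Pair-cotrans {T} {u} {v} {w} ¬T (A , pA , mA) (v′ , B , pB , mB) v≢u v≢w
    with ∈-resp-↭ pA (↭⇒∈ pB)
  ... | here v≡u = ⊥-elim (v≢u v≡u)
  ... | there (here v≡w) = ⊥-elim (v≢w v≡w)
  ... | there (there v∈A) with exchange _ [] ℕ.≤-refl ¬T pA mA pB mB v∈A
  ... | inj₂ (t , inj₁ refl , P) = inj₁ (Pair-sym P)
  ... | inj₂ (t , inj₂ refl , P) = inj₂ P

  -- This is the summand of `degree`, so a degree is by computation a `sumOver` of it.
  adjℕ : V → V → ℕ
  adjℕ u v = if adj u v then 1 else 0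

  adjℕ-≤1 : ∀ u v → adjℕ u v ≤ 1
  adjℕ-≤1 u v with adj u v
  ... | true  = ℕ.≤-refl
  ... | false = z≤n

  ¬Edge⇒adjℕ≡0 : ∀ {u v} → ¬ Edge G u v → adjℕ u v ≡ 0
  ¬Edge⇒adjℕ≡0 {u} {v} ¬e with adj u v
  ... | true  = ⊥-elim (¬e refl)
  ... | false = refl

  adjℕ-≤-indicator : ∀ {P : Set} {u v} (d : Dec P) → (Edge G u v → P) → adjℕ u v ≤ indicator d
  adjℕ-≤-indicator {u = u} {v} d h with adj u v | d
  ... | false | _ = z≤n
  ... | true | yes _ = ℕ.≤-refl
  ... | true | no ¬p = ⊥-elim (¬p (h refl))

  adjℕ+indicator≤1 : ∀ {P : Set} {u v} (d : Dec P) → (Edge G u v → ¬ P) → adjℕ u v + indicator d ≤ 1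
  adjℕ+indicator≤1 {u = u} {v} d h with adj u v | d
  ... | false | d = indicator-≤1 d
  ... | true | no _ = ℕ.≤-refl
  ... | true | yes p = ⊥-elim (h refl p)

  adjℕ+adjℕ≤1 : ∀ {a b c d} → (Edge G a b → ¬ Edge G c d) → adjℕ a b + adjℕ c d ≤ 1
  adjℕ+adjℕ≤1 {a} {b} {c} {d} h with adj a b | adj c d
  ... | false | false = z≤n
  ... | false | true  = ℕ.≤-refl
  ... | true  | false = ℕ.≤-refl
  ... | true  | true  = ⊥-elim (h refl refl)

  -- For an edge uv of the matching, `t₁` and `t₂` cannot be joined to different ends, since two
  -- edges could then replace uv. So the two vertices send at most two edges in total to each
  -- matching edge.
  unaugmentable-degrees : ∀ {t₁ t₂ A} → Matchable G A → ¬ Matchable G (t₁ ∷ t₂ ∷ A) →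
    sumOver A (adjℕ t₁) + sumOver A (adjℕ t₂) ≤ length A
  unaugmentable-degrees empty ¬m = z≤n
  unaugmentable-degrees {t₁} {t₂} {A} (pair {u} {v} {L} e m p) ¬m =
    subst₂ _≤_ (sym (trans (cong₂ _+_ (sumOver-↭ _ p) (sumOver-↭ _ p))
                  (regroup (adjℕ t₁ u) (adjℕ t₁ v) _ (adjℕ t₂ u) (adjℕ t₂ v) _)))
      (sym (↭-length p))
      (ℕ.+-mono-≤ (adjℕ+adjℕ≤1 uv) (ℕ.+-mono-≤ (adjℕ+adjℕ≤1 vu)
        (unaugmentable-degrees m λ m′ → ¬m (pair e m′
          (↭-trans (prep t₁ (prep t₂ p)) (perm t₁ t₂ u v))))))
    where
    regroup : ∀ a b x c d y → (a + (b + x)) + (c + (d + y)) ≡ (a + d) + ((b + c) + (x + y))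
    regroup = solve-∀
    perm : ∀ a b c d → a ∷ b ∷ c ∷ d ∷ L ↭ c ∷ d ∷ a ∷ b ∷ L
    perm a b c d = solve 5 (λ a b c d l → a ⊕ b ⊕ c ⊕ d ⊕ l ⊜ c ⊕ d ⊕ a ⊕ b ⊕ l) ↭-refl
      [ a ] [ b ] [ c ] [ d ] L
    uv : Edge G t₁ u → ¬ Edge G t₂ v
    uv e₁ e₂ = ¬m (pair e₁ (pair e₂ m ↭-refl) (↭-trans (prep t₁ (prep t₂ p))
      (prep t₁ (swap t₂ u ↭-refl))))
    vu : Edge G t₁ v → ¬ Edge G t₂ u
    vu e₁ e₂ = ¬m (pair e₁ (pair e₂ m ↭-refl) (↭-trans (prep t₁ (prep t₂ p))
      (solve 5 (λ a b c d l → a ⊕ b ⊕ c ⊕ d ⊕ l ⊜ a ⊕ d ⊕ b ⊕ c ⊕ l) ↭-refl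
        [ t₁ ] [ t₂ ] [ u ] [ v ] L)))

-- Deficient halves of the vertex set

complement-size : ∀ {n N} → N + N ≡ n → ∀ T W → T ++ W ↭ allFin n → length T ≡ N → length W ≡ N
complement-size {n} {N} order T W c s = ℕ.+-cancelˡ-≡ N _ _ (begin
  N + length W        ≡⟨ cong (_+ length W) (sym s) ⟩
  length T + length W ≡⟨ sym (length-++ T) ⟩
  length (T ++ W)     ≡⟨ ↭-length c ⟩
  length (allFin n)   ≡⟨ length-tabulate _ ⟩
  n                   ≡⟨ sym order ⟩
  N + N               ∎)
  where open ≡-Reasoning

-- With N = 2k, `exchangeable` is the form in which k-extendability enters.
module Deficiency {n : ℕ} (G : Graph n) (N : ℕ)
  (exchangeable : ∀ {X Y} → X ++ Y ↭ allFin n → length X ≡ N → Matchable G X → Matchable G Y)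
  (order : N + N ≡ n) (deg : ∀ v → suc N ≤ degree G v)
  where
  private
    V : Set
    V = Fin n

  record Deficient (T W : List V) : Set where
    field
      cover       : T ++ W ↭ allFin n
      card        : length T ≡ N
      unmatchable : ¬ Matchable G T
      pairing     : ∃₂ (Pair G T)

  open Deficient

  degree-split : ∀ T W → T ++ W ↭ allFin n → ∀ v →
    suc N ≤ sumOver T (adjℕ G v) + sumOver W (adjℕ G v)
  degree-split T W c v = subst (suc N ≤_)
    (trans (sym (sumOver-↭ (adjℕ G v) c)) (sumOver-++ T W (adjℕ G v))) (deg v)

  -- A near-perfect matching of T together with t₁w covers N vertices, so its complement is matchable.
  cross-edge : ∀ {T W t₁ w} → Deficient T W → Missable G T t₁ → w ∈ W → Edge G t₁ w →
    Missable G W w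
  cross-edge {T} {W} {t₁} {w} D (t₂ , A , p , m) w∈W e with W₀ , q ← ∈⇒↭ w∈W
    -- The complement is `t₂` together with `W₀`. Removing `t₂` and its partner `w₂` leaves a
    -- matching of `W` that misses `w` and `w₂`.
    with w₂ , L , _ , mL , r ← partner G
      (exchangeable {w ∷ t₁ ∷ A} {t₂ ∷ W₀}
        (↭-trans (↭-sym (↭-trans (++⁺ p q)
          (solve 5 (λ a b l w x → (a ⊕ b ⊕ l) ⊕ (w ⊕ x) ⊜ (w ⊕ a ⊕ l) ⊕ (b ⊕ x)) ↭-refl
            [ t₁ ] [ t₂ ] A [ w ] W₀))) (cover D))
        (trans (sym (↭-length p)) (card D))
        (pair (Edge-sym G e) m ↭-refl))
      (here refl)
    = w₂ , L , ↭-trans q (prep w (drop-∷ r)) , mL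

  -- A matching of `W` would give one of `T` by `exchangeable`. A missed vertex `t₁` has more than N
  -- neighbours, too many for `T`, so it has one in `W`, which `cross-edge` makes missable.
  Deficient-sym : ∀ {T W} → Deficient T W → Deficient W T
  Deficient-sym {T} {W} D = record
    { cover = cover′
    ; card = sizeW
    ; unmatchable = λ m → unmatchable D (exchangeable cover′ sizeW m)
    ; pairing = pairingW
    }
    where
    cover′ = ↭-trans (++-comm W T) (cover D)
    sizeW = complement-size order T W (cover D) (card D)
    pairingW : ∃₂ (Pair G W)
    pairingW with t₁ , t₂ , P ← pairing D with any? (λ w → (w ∈? W) ×-dec Edge? G t₁ w)
    ... | yes (w , w∈W , e) = w , cross-edge D (t₂ , P) w∈W e
    ... | no none = ⊥-elim (ℕ.<-irrefl refl (begin
      suc N                                         ≤⟨ degree-split T W (cover D) t₁ ⟩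
      sumOver T (adjℕ G t₁) + sumOver W (adjℕ G t₁) ≤⟨ ℕ.+-mono-≤
        (sumOver-≤-length T (λ {x} _ → adjℕ-≤1 G t₁ x))
        (sumOver-mono W {g = λ _ → 0} λ {x} x∈W →
          ℕ.≤-reflexive (¬Edge⇒adjℕ≡0 G (λ e → none (x , x∈W , e)))) ⟩
      length T + sumOver W (λ _ → 0)                ≡⟨ cong₂ _+_ (card D) (sumOver-0 W) ⟩
      N + 0                                         ≡⟨ ℕ.+-identityʳ N ⟩
      N                                             ∎))
      where open ℕ.≤-Reasoning

  missables : List V → ℕ
  missables T = sumOver T (λ v → indicator (Missable? G T v))

  missables-≤ : ∀ {T W} → Deficient T W → missables T ≤ N
  missables-≤ {T} D = subst (missables T ≤_) (card D)
    (sumOver-≤-length T (λ {v} _ → indicator-≤1 (Missable? G T v)))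

  -- Two vertices missed together have total degree at least 2N + 2, of which at most N - 2 falls
  -- inside `T` by `unaugmentable-degrees`. The other N + 4 edges end in D(W) by `cross-edge`, at
  -- most twice at each vertex.
  many-missables : ∀ {T W} → Deficient T W → N + 4 ≤ missables W + missables W
  many-missables {T} {W} D with t₁ , t₂ , P@(A , p , m) ← pairing D = ℕ.+-cancelˡ-≤ (length A) _ _ (begin
      length A + (N + 4)                             ≡⟨ shuffle (length A) N ⟩
      (2 + length A) + (N + 2)                       ≡⟨ cong (_+ (N + 2)) (trans (sym (↭-length p)) (card D)) ⟩
      N + (N + 2)                                    ≡⟨ double N ⟩
      suc N + suc N                                  ≤⟨ ℕ.+-mono-≤ (degree-split T W (cover D) t₁) (degree-split T W (cover D) t₂) ⟩
      (sT t₁ + sW t₁) + (sT t₂ + sW t₂)              ≡⟨ interchange (sT t₁) (sW t₁) (sT t₂) (sW t₂) ⟩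
      (sT t₁ + sT t₂) + (sW t₁ + sW t₂)              ≤⟨ ℕ.+-mono-≤ inner (ℕ.+-mono-≤ (outer (t₂ , P)) (outer (t₁ , Pair-sym G P))) ⟩
      length A + (missables W + missables W)         ∎)
    where
    open ℕ.≤-Reasoning
    open import Algebra.Properties.CommutativeSemigroup ℕ.+-commutativeSemigroup using (interchange)
    sT sW : V → ℕ
    sT v = sumOver T (adjℕ G v)
    sW v = sumOver W (adjℕ G v)
    shuffle : ∀ a b → a + (b + 4) ≡ (2 + a) + (b + 2)
    shuffle = solve-∀
    double : ∀ a → a + (a + 2) ≡ suc a + suc a
    double = solve-∀
    ¬t₁t₂ = Pair⇒¬Edge G (unmatchable D) P
    outer : ∀ {t} → Missable G T t → sW t ≤ missables W
    outer {t} mt = sumOver-mono W λ {w} w∈W →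
      adjℕ-≤-indicator G (Missable? G W w) (cross-edge D mt w∈W)
    sT≡ : ∀ {t} → ¬ Edge G t t₁ → ¬ Edge G t t₂ → sT t ≡ sumOver A (adjℕ G t)
    sT≡ ¬e₁ ¬e₂ = trans (sumOver-↭ _ p)
      (cong₂ (λ a b → a + (b + sumOver A _)) (¬Edge⇒adjℕ≡0 G ¬e₁) (¬Edge⇒adjℕ≡0 G ¬e₂))
    inner : sT t₁ + sT t₂ ≤ length A
    inner = subst (_≤ length A)
      (sym (cong₂ _+_ (sT≡ (λ e → Edge-irrefl G e refl) ¬t₁t₂)
                      (sT≡ (¬t₁t₂ ∘ Edge-sym G) (λ e → Edge-irrefl G e refl))))
      (unaugmentable-degrees G m (λ m′ → unmatchable D (Matchable-resp-↭ G (↭-sym p) m′)))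

  -- By `cross-edge` from the other side, no neighbour of `x` in `W` lies in D(W). If none lay in
  -- D(T) either, the degree of `x` plus |D(T)| + |D(W)| would be at most 2N, against
  -- `many-missables`.
  unmissable-neighbour : ∀ {T W x} → Deficient T W → x ∈ T → ¬ Missable G T x →
    ∃ λ d → d ∈ T × Missable G T d × Edge G x d
  unmissable-neighbour {T} {W} {x} D x∈T ¬x
    with any? (λ d → (d ∈? T) ×-dec (Missable? G T d ×-dec Edge? G x d))
  ... | yes (d , r) = d , r
  ... | no none = ⊥-elim (ℕ.<-irrefl refl (ℕ.<-≤-trans surplus (begin
      -- The count is doubled because `many-missables` bounds twice a cardinality.
      (N + 4) + (N + 4) + (suc N + suc N)  ≤⟨ ℕ.+-mono-≤ (ℕ.+-mono-≤ (many-missables (Deficient-sym D)) (many-missables D))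
                                                         (ℕ.+-mono-≤ (degree-split T W (cover D) x) (degree-split T W (cover D) x)) ⟩
      (mT + mT) + (mW + mW) + ((a + b) + (a + b))  ≡⟨ regroup mT mW a b ⟩
      ((a + mT) + (b + mW)) + ((a + mT) + (b + mW)) ≤⟨ ℕ.+-mono-≤ bound bound ⟩
      (N + N) + (N + N)                            ∎)))
    where
    open ℕ.≤-Reasoning
    mT = missables T
    mW = missables W
    a = sumOver T (adjℕ G x)
    b = sumOver W (adjℕ G x)
    regroup : ∀ t w a b → (t + t) + (w + w) + ((a + b) + (a + b)) ≡ ((a + t) + (b + w)) + ((a + t) + (b + w))
    regroup = solve-∀
    expand : ∀ N → (N + 4) + (N + 4) + (suc N + suc N) ≡ (N + N) + (N + N) + 10
    expand = solve-∀
    surplus : (N + N) + (N + N) < (N + 4) + (N + 4) + (suc N + suc N)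
    surplus = subst ((N + N) + (N + N) <_) (sym (expand N)) (ℕ.m<m+n _ (s≤s z≤n))
    bound : (a + mT) + (b + mW) ≤ N + N
    bound = subst₂ _≤_
      (cong₂ _+_ (sumOver-+ T _ _) (sumOver-+ W _ _))
      (cong₂ _+_ (card D) (complement-size order T W (cover D) (card D)))
      (ℕ.+-mono-≤
        (sumOver-≤-length T λ {v} v∈T →
          adjℕ+indicator≤1 G (Missable? G T v) λ e mv → none (v , v∈T , mv , e))
        (sumOver-≤-length W λ {w} w∈W →
          adjℕ+indicator≤1 G (Missable? G W w) λ e mw →
            ¬x (cross-edge (Deficient-sym D) mw x∈T (Edge-sym G e))))

  -- An edge joining `x` and `x′` would lie in some maximum matching of `T`. Since `x` has a
  -- neighbour `d` in D(T), that matching can be changed to miss `d` while keeping this edge;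
  -- replacing the edge by the one from `x` to `d` then frees `x′`.
  unmissable-independent : ∀ {T W x x′} → Deficient T W → x ∈ T → x′ ∈ T →
    ¬ Missable G T x → ¬ Missable G T x′ → ¬ Edge G x x′
  unmissable-independent {T} {W} {x} {x′} D x∈T x′∈T ¬x ¬x′ e
    with T′ , q ← ∈⇒↭ x∈T
    with ∈-resp-↭ q x′∈T
  ... | here refl = Edge-irrefl G e refl
  ... | there x′∈T′
    with T₀ , r ← ∈⇒↭ x′∈T′
    with y₁ , y₂ , P@(B , pW , mB) ← pairing (Deficient-sym D)
    -- A maximum matching of `W` plus the supposed edge covers N vertices, so the missed `y₁`, `y₂`
    -- and the rest `T₀` of `T` are matched. As `y₁` and `y₂` are not adjacent, their partners `t₁`,
    -- `t₂` lie in `T₀`.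
    with partner G
      (exchangeable {x ∷ x′ ∷ B} {y₁ ∷ y₂ ∷ T₀}
        (↭-trans (↭-sym (↭-trans (++⁺ (↭-trans q (prep x r)) pW)
          (solve 6 (λ a b t c d l → (a ⊕ b ⊕ t) ⊕ (c ⊕ d ⊕ l) ⊜ (a ⊕ b ⊕ l) ⊕ (c ⊕ d ⊕ t)) ↭-refl
            [ x ] [ x′ ] T₀ [ y₁ ] [ y₂ ] B))) (cover D))
        (trans (sym (↭-length pW)) (card (Deficient-sym D)))
        (pair e mB ↭-refl))
      (here refl)
  ... | t₁ , L₁ , e₁ , mL₁ , p₁ with ∈-resp-↭ (drop-∷ p₁) (here refl)
  ... | here refl = Pair⇒¬Edge G (unmatchable (Deficient-sym D)) P e₁
  ... | there y₂∈L₁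
    with t₂ , L , _ , mL , p₂ ← partner G mL₁ y₂∈L₁
    with d , d∈T , (d′ , B′ , pd , md) , ed ← unmissable-neighbour D x∈T ¬x
    = absurd (∈-resp-↭ T↭ d∈T)
    where
    T₀↭ : T₀ ↭ t₁ ∷ t₂ ∷ L
    T₀↭ = drop-∷ (↭-trans (drop-∷ p₁) (↭-trans (prep t₁ p₂) (swap t₁ y₂ ↭-refl)))
    T↭ : T ↭ x ∷ x′ ∷ t₁ ∷ t₂ ∷ L
    T↭ = ↭-trans q (prep x (↭-trans r (prep x′ T₀↭)))
    absurd : d ∈ x ∷ x′ ∷ t₁ ∷ t₂ ∷ L → ⊥
    absurd (here refl) = Edge-irrefl G ed refl
    absurd (there (here refl)) = ¬x′ (d′ , B′ , pd , md)
    absurd (there (there (here refl))) = ¬x′ (t₂ , x ∷ t₁ ∷ L ,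
      ↭-trans T↭ (solve 5 (λ a b c d l → a ⊕ b ⊕ c ⊕ d ⊕ l ⊜ b ⊕ d ⊕ a ⊕ c ⊕ l) ↭-refl
        [ x ] [ x′ ] [ t₁ ] [ t₂ ] L) , pair ed mL ↭-refl)
    absurd (there (there (there (here refl)))) = ¬x′ (t₁ , x ∷ t₂ ∷ L ,
      ↭-trans T↭ (solve 5 (λ a b c d l → a ⊕ b ⊕ c ⊕ d ⊕ l ⊜ b ⊕ c ⊕ a ⊕ d ⊕ l) ↭-refl
        [ x ] [ x′ ] [ t₁ ] [ t₂ ] L) , pair ed mL ↭-refl)
    -- Keeping `x` and `x′` aside saves their edge during the exchange, unless the path reaches one
    -- of them, which would make it missable.
    absurd (there (there (there (there d∈L))))
      with exchange G _ (x ∷ x′ ∷ []) ℕ.≤-refl (unmatchable D) T↭ mL pd md d∈L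
    ... | inj₁ (_ , here refl , mx) = ¬x mx
    ... | inj₁ (_ , there (here refl) , mx′) = ¬x′ mx′
    ... | inj₂ (t , _ , M , s , m) = ¬x′ (t , x ∷ d ∷ M ,
      ↭-trans s (solve 5 (λ a b c d l → a ⊕ b ⊕ c ⊕ d ⊕ l ⊜ b ⊕ d ⊕ a ⊕ c ⊕ l) ↭-refl
        [ x ] [ x′ ] [ d ] [ t ] M) , pair ed m ↭-refl)

  -- By independence, the neighbours of `x` in `T` lie in D(T), while those in `W` avoid D(W). So N
  -- + 1 is at most |D(T)| + N - |D(W)|.
  unmissable⇒imbalance : ∀ {T W x} → Deficient T W → x ∈ T → ¬ Missable G T x →
    missables W < missables T
  unmissable⇒imbalance {T} {W} {x} D x∈T ¬x = ℕ.+-cancelʳ-≤ N _ _ (begin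
      suc (missables W) + N                    ≡⟨ cong suc (ℕ.+-comm (missables W) N) ⟩
      suc N + missables W                      ≤⟨ ℕ.+-monoˡ-≤ (missables W) (degree-split T W (cover D) x) ⟩
      (a + b) + missables W                    ≡⟨ ℕ.+-assoc a b _ ⟩
      a + (b + missables W)                    ≤⟨ ℕ.+-mono-≤ inner outer ⟩
      missables T + N                          ∎)
    where
    open ℕ.≤-Reasoning
    a = sumOver T (adjℕ G x)
    b = sumOver W (adjℕ G x)
    inner : a ≤ missables T
    inner = sumOver-mono T λ {v} v∈T → adjℕ-≤-indicator G (Missable? G T v) λ e →
      decidable-stable (Missable? G T v) λ ¬v → unmissable-independent D x∈T v∈T ¬x ¬v e
    outer : b + missables W ≤ N
    outer = subst₂ _≤_ (sumOver-+ W _ _) (complement-size order T W (cover D) (card D))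
      (sumOver-≤-length W λ {w} w∈W → adjℕ+indicator≤1 G (Missable? G W w) λ e mw →
        ¬x (cross-edge (Deficient-sym D) mw x∈T (Edge-sym G e)))

  -- An unmissable vertex on each side gives two opposite strict inequalities. If only `T` has one,
  -- then |D(W)| = N, and |D(T)| cannot exceed it.
  all-missable : ∀ {T W x} → Deficient T W → x ∈ T → Missable G T x
  all-missable {T} {W} {x} D x∈T = decidable-stable (Missable? G T x) absurd
    where
    absurd : ¬ ¬ Missable G T x
    absurd ¬x with any? (λ y → (y ∈? W) ×-dec ¬? (Missable? G W y))
    ... | yes (y , y∈W , ¬y) = ℕ.<-asym (unmissable⇒imbalance D x∈T ¬x)
                                        (unmissable⇒imbalance (Deficient-sym D) y∈W ¬y)
    ... | no none = ℕ.<-irrefl refl (ℕ.<-≤-trans (unmissable⇒imbalance D x∈T ¬x)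
      (ℕ.≤-trans (missables-≤ D) (subst (_≤ missables W)
        (trans (sumOver-1 W) (card (Deficient-sym D)))
        (sumOver-mono W {f = λ _ → 1} λ {y} y∈W → one (Missable? G W y)
          λ ¬y → none (y , y∈W , ¬y)))))
      where
      one : ∀ {P} (d : Dec P) → ¬ ¬ P → 1 ≤ indicator d
      one (yes _) _ = ℕ.≤-refl
      one (no ¬p) ¬¬p = ⊥-elim (¬¬p ¬p)

-- Parity and factor-critical components

Unique-resp-↭ : ∀ {A : Set} {xs ys : List A} → xs ↭ ys → Unique xs → Unique ys
Unique-resp-↭ {A} p = PermutationSetoid.Unique-resp-↭ (setoid A) (↭⇒↭ₛ p)

odd≢even : ∀ i j → suc (i + i) ≢ j + j
odd≢even zero (suc j) eq with () ← trans (ℕ.suc-injective eq) (ℕ.+-suc j j)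
odd≢even (suc i) (suc j) eq = odd≢even i j (ℕ.suc-injective (ℕ.suc-injective
  (trans (cong (suc ∘ suc) (sym (ℕ.+-suc i i))) (trans eq (cong suc (ℕ.+-suc j j))))))

+-self-injective : ∀ {i j} → i + i ≡ j + j → i ≡ j
+-self-injective {zero} {zero} _ = refl
+-self-injective {suc i} {suc j} eq = cong suc (+-self-injective (ℕ.suc-injective
  (trans (sym (ℕ.+-suc i i)) (trans (ℕ.suc-injective eq) (ℕ.+-suc j j)))))

module _ {n : ℕ} (G : Graph n) where

  private
    V : Set
    V = Fin n

  FactorCriticalList : List V → Set
  FactorCriticalList C = ∀ {v} → v ∈ C → ∃ λ A → C ↭ v ∷ A × Matchable G A

  factorCritical-odd : ∀ {C v} → FactorCriticalList C → v ∈ C → ∃ λ j → length C ≡ suc (j + j)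
  factorCritical-odd fc v∈C with A , p , m ← fc v∈C with j , eq ← Matchable-even G m =
    j , trans (↭-length p) (cong suc eq)

  -- If `u` satisfies `P` and `v` does not, the matching of `C` without `u` makes the number of
  -- vertices satisfying `P` odd, and the matching without `v` makes it even.
  factorCritical-closed : ∀ {C u} {P : V → Set} (P? : Decidable P) → FactorCriticalList C →
    (∀ {v w} → v ∈ C → w ∈ C → Edge G v w → P v → P w) →
    u ∈ C → P u → ∀ {v} → v ∈ C → P v
  factorCritical-closed {C} {u} {P} P? fc closed u∈C pu {v} v∈C = decidable-stable (P? v) λ ¬pv →
    let A , p , mA = fc u∈C
        B , q , mB = fc v∈C
        i , eqA = Matchable-even G (Matchable-filter G P? mA λ a b →
          closed (∈-resp-↭ (↭-sym p) (there a)) (∈-resp-↭ (↭-sym p) (there b)))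
        j , eqB = Matchable-even G (Matchable-filter G P? mB λ a b →
          closed (∈-resp-↭ (↭-sym q) (there a)) (∈-resp-↭ (↭-sym q) (there b)))
    in odd≢even i j (begin
      suc (i + i)                       ≡⟨ cong suc (sym eqA) ⟩
      length (u ∷ filter P? A)          ≡⟨ cong length (sym (filter-accept P? pu)) ⟩
      length (filter P? (u ∷ A))        ≡⟨ ↭-length (filter-↭ P? (↭-trans (↭-sym p) q)) ⟩
      length (filter P? (v ∷ B))        ≡⟨ cong length (filter-reject P? ¬pv) ⟩
      length (filter P? B)              ≡⟨ eqB ⟩
      j + j                             ∎)
    where open ≡-Reasoning

  -- Q need not be decidable, so the parity argument is applied to a finite set of vertices
  -- satisfying Q that has been grown until it is closed.
  factorCritical-connected : ∀ {C u} {Q : V → Set} → FactorCriticalList C →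
    (∀ {v w} → v ∈ C → w ∈ C → Edge G v w → Q v → Q w) →
    u ∈ C → Q u → ∀ {v} → v ∈ C → Q v
  factorCritical-connected {C} {u} {Q} fc closed u∈C qu {v} v∈C
    with A , p , _ ← fc u∈C = grow (length A) (u ∷ []) A ℕ.≤-refl p (here refl) λ { (here refl) → qu }
    where
    grow : ∀ f R S → length S ≤ f → C ↭ R ++ S → u ∈ R → (∀ {w} → w ∈ R → Q w) → Q v
    grow f R S le p u∈R allQ
      with any? (λ r → any? (λ s → (r ∈? R) ×-dec ((s ∈? S) ×-dec Edge? G r s)))
    ... | no none = allQ (factorCritical-closed (_∈? R) fc R-closed u∈C u∈R v∈C)
      where
      R-closed : ∀ {v w} → v ∈ C → w ∈ C → Edge G v w → v ∈ R → w ∈ R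
      R-closed {v} {w} _ w∈C e v∈R with ∈-++⁻ R (∈-resp-↭ p w∈C)
      ... | inj₁ w∈R = w∈R
      ... | inj₂ w∈S = ⊥-elim (none (v , w , v∈R , w∈S , e))
    grow zero R [] le p u∈R allQ | yes (r , s , r∈R , () , e)
    grow (suc f) R S le p u∈R allQ | yes (r , s , r∈R , s∈S , e) with S′ , q ← ∈⇒↭ s∈S =
      grow f (s ∷ R) S′ (ℕ.≤-pred (subst (_≤ suc f) (↭-length q) le))
        (↭-trans p (↭-trans (++⁺ˡ R q) (shift s R S′))) (there u∈R)
        λ { (here refl) → closed (in-C (∈-++⁺ˡ r∈R)) (in-C (∈-++⁺ʳ R s∈S)) e (allQ r∈R)
          ; (there w∈R) → allQ w∈R }
      where
      in-C : ∀ {w} → w ∈ R ++ S → w ∈ C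
      in-C = ∈-resp-↭ (↭-sym p)

  record TwoComponents (T : List V) : Set where
    field
      C₁ C₂     : List V
      split     : T ↭ C₁ ++ C₂
      inhabited₁ : ∃ (_∈ C₁)
      inhabited₂ : ∃ (_∈ C₂)
      separated : ∀ {u v} → u ∈ C₁ → v ∈ C₂ → ¬ Edge G u v
      critical₁ : FactorCriticalList C₁
      critical₂ : FactorCriticalList C₂

  TwoComponents-swap : ∀ {T} → TwoComponents T → TwoComponents T
  TwoComponents-swap S = record
    { C₁ = C₂ ; C₂ = C₁ ; split = ↭-trans split (++-comm C₁ C₂)
    ; inhabited₁ = inhabited₂ ; inhabited₂ = inhabited₁
    ; separated = λ u∈ v∈ e → separated v∈ u∈ (Edge-sym G e)
    ; critical₁ = critical₂ ; critical₂ = critical₁ }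
    where open TwoComponents S

  -- A vertex of `C₁` has no neighbour in `C₂` and is not its own neighbour. This bounds the
  -- components from below, both for the size 3 and in the case of large minimum degree.
  degree-< : ∀ {T W} → T ++ W ↭ allFin n → (S : TwoComponents T) →
    ∀ {v} → v ∈ TwoComponents.C₁ S → degree G v < length (TwoComponents.C₁ S) + length W
  degree-< {T} {W} cover S {v} v∈C₁ with A , p , _ ← TwoComponents.critical₁ S v∈C₁ = begin
    suc (degree G v)                            ≡⟨ cong suc (sym (sumOver-↭ f (↭-trans (++⁺ʳ W (↭-sym split)) cover))) ⟩
    suc (sumOver ((C₁ ++ C₂) ++ W) f)           ≡⟨ cong suc (trans (sumOver-++ (C₁ ++ C₂) W f)
                                                     (cong (_+ sumOver W f) (sumOver-++ C₁ C₂ f))) ⟩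
    suc ((sumOver C₁ f + sumOver C₂ f) + sumOver W f) ≤⟨ s≤s (ℕ.+-mono-≤ (ℕ.+-mono-≤ inside across) (≤-length W)) ⟩
    suc ((length A + 0) + length W)             ≡⟨ cong (λ a → suc a + length W) (ℕ.+-identityʳ (length A)) ⟩
    suc (length A) + length W                   ≡⟨ cong (_+ length W) (sym (↭-length p)) ⟩
    length C₁ + length W                        ∎
    where
    open ℕ.≤-Reasoning
    open TwoComponents S
    f = adjℕ G v
    ≤-length : ∀ L → sumOver L f ≤ length L
    ≤-length L = sumOver-≤-length L λ {x} _ → adjℕ-≤1 G v x
    inside : sumOver C₁ f ≤ length A
    inside = subst (_≤ length A)
      (sym (trans (sumOver-↭ f p) (cong (_+ sumOver A f) (¬Edge⇒adjℕ≡0 G (λ e → Edge-irrefl G e refl)))))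
      (≤-length A)
    across : sumOver C₂ f ≤ 0
    across = ℕ.≤-trans (sumOver-mono C₂ {g = λ _ → 0} λ x∈C₂ →
      ℕ.≤-reflexive (¬Edge⇒adjℕ≡0 G (separated v∈C₁ x∈C₂))) (ℕ.≤-reflexive (sumOver-0 C₂))

  -- The components are the classes of the non-pairing relation; they turn out to be
  -- connected because they are factor-critical.
  two-components : ∀ {T t₁ t₂} → Unique T → ¬ Matchable G T → (∀ {v} → v ∈ T → Missable G T v) →
    Pair G T t₁ t₂ → TwoComponents T
  two-components {T} {t₁} {t₂} unique ¬T missable P = record
    { C₁ = filter ¬P? T ; C₂ = filter P? T
    ; split = ↭-sym (↭-trans (++-comm (filter ¬P? T) _) (filter-complement P? T))
    ; inhabited₁ = t₁ , ∈-filter⁺ ¬P? t₁∈T t₁¬t₁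
    ; inhabited₂ = t₂ , ∈-filter⁺ P? (↭⇒∈ (proj₁ (proj₂ (Pair-sym G P)))) P
    ; separated = λ u∈C₁ v∈C₂ e →
        let u∈T , ¬t₁u = ∈-filter⁻ ¬P? u∈C₁
            v∈T , t₁v  = ∈-filter⁻ P? v∈C₂
        in ¬t₁u (closed u∈T v∈T e t₁v)
    ; critical₁ = critical₁
    ; critical₂ = critical₂
    }
    where
    P? = Pair? G T t₁
    ¬P? = ¬? ∘ P?
    t₁∈T : t₁ ∈ T
    t₁∈T = ↭⇒∈ (proj₁ (proj₂ P))
    t₁¬t₁ : ¬ Pair G T t₁ t₁
    t₁¬t₁ (L , p , _) = Unique-head (Unique-resp-↭ p unique) (here refl)
    -- Cotransitivity makes `u` a pair with `t₁` or with `v`, and adjacent vertices are never a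
    -- pair.
    closed : ∀ {u v} → u ∈ T → v ∈ T → Edge G u v → Pair G T t₁ v → Pair G T t₁ u
    closed {u} {v} u∈T v∈T e t₁v with u ≟ t₁
    ... | yes refl = ⊥-elim (Pair⇒¬Edge G ¬T t₁v e)
    ... | no u≢t₁ with Pair-cotrans G ¬T t₁v (missable u∈T) u≢t₁ (Edge-irrefl G e)
    ... | inj₁ t₁u = t₁u
    ... | inj₂ uv = ⊥-elim (Pair⇒¬Edge G ¬T uv e)
    critical₁ : FactorCriticalList (filter ¬P? T)
    critical₁ {v} v∈C₁
      with v∈T , ¬t₁v ← ∈-filter⁻ ¬P? v∈C₁
      with w , A , p , m ← missable v∈T =
      filter ¬P? A ,
      ↭-trans (filter-↭ ¬P? p) (subst (_↭ v ∷ filter ¬P? A)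
        (sym (trans (filter-accept ¬P? ¬t₁v) (cong (v ∷_) (filter-reject ¬P? (λ f → f t₁w))))) ↭-refl) ,
      Matchable-filter G ¬P? m λ a b e ¬t₁a t₁b → ¬t₁a (closed (in-T a) (in-T b) e t₁b)
      where
      in-T : ∀ {x} → x ∈ A → x ∈ T
      in-T x∈A = ∈-resp-↭ (↭-sym p) (there (there x∈A))
      -- As `v` is not a pair with `t₁`, the other missed vertex `w` is. Hence `w` lies in the other
      -- class, and the class of `v` loses only `v`.
      t₁w : Pair G T t₁ w
      t₁w with t₁ ≟ v | t₁ ≟ w
      ... | yes refl | _ = A , p , m
      ... | no _ | yes refl = ⊥-elim (¬t₁v (Pair-sym G (A , p , m)))
      ... | no t₁≢v | no t₁≢w with Pair-cotrans G ¬T (A , p , m) (missable t₁∈T) t₁≢v t₁≢w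
      ... | inj₁ vt₁ = ⊥-elim (¬t₁v (Pair-sym G vt₁))
      ... | inj₂ t₁w = t₁w
    critical₂ : FactorCriticalList (filter P? T)
    critical₂ {v} v∈C₂ with _ , t₁v@(A , p , m) ← ∈-filter⁻ P? {xs = T} v∈C₂ =
      filter P? A ,
      ↭-trans (filter-↭ P? p) (subst (_↭ v ∷ filter P? A)
        (sym (trans (filter-reject P? t₁¬t₁) (filter-accept P? t₁v))) ↭-refl) ,
      Matchable-filter G P? m λ a b e t₁a → closed (in-T b) (in-T a) (Edge-sym G e) t₁a
      where
      in-T : ∀ {x} → x ∈ A → x ∈ T
      in-T x∈A = ∈-resp-↭ (↭-sym p) (there (there x∈A))

-- Duplicate-free lists and subsets

Unique-↭ : ∀ {A : Set} {xs ys : List A} → Unique xs → Unique ys →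
  (∀ {x} → x ∈ xs → x ∈ ys) → (∀ {x} → x ∈ ys → x ∈ xs) → xs ↭ ys
Unique-↭ uxs uys f g = ∼bag⇒↭ (unique∧set⇒bag uxs uys (mk⇔ f g))

Unique-tail : ∀ {A : Set} {x : A} {xs} → Unique (x ∷ xs) → Unique xs
Unique-tail (_ ∷ u) = u

Unique-++ˡ : ∀ {A : Set} (xs : List A) {ys} → Unique (xs ++ ys) → Unique xs
Unique-++ˡ [] u = []
Unique-++ˡ (x ∷ xs) (x∉ ∷ u) = All.tabulate (λ y∈xs → All.lookup x∉ (∈-++⁺ˡ y∈xs)) ∷ Unique-++ˡ xs u

Unique-++-disjoint : ∀ {A : Set} (xs : List A) {ys x} → Unique (xs ++ ys) → x ∈ xs → x ∉ ys
Unique-++-disjoint (x ∷ xs) u (here refl) x∈ys = Unique-head u (∈-++⁺ʳ xs x∈ys)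
Unique-++-disjoint (x ∷ xs) (_ ∷ u) (there x∈xs) = Unique-++-disjoint xs u x∈xs

∈─⇒∉ : ∀ {n} {p q : Subset n} {x} → x ∈ₛ p ─ q → x ∉ₛ q
∈─⇒∉ {p = _ ∷ p} {_ ∷ q} (Vec.there x∈) (Vec.there x∈q) = ∈─⇒∉ {p = p} {q} x∈ x∈q
∈─⇒∉ {p = true  ∷ p} {true ∷ q} () Vec.here
∈─⇒∉ {p = false ∷ p} {true ∷ q} () Vec.here

module _ {n : ℕ} where

  elements : Subset n → List (Fin n)
  elements S = filter (_∈ₛ? S) (allFin n)

  fromList : List (Fin n) → Subset n
  fromList L = Vec.tabulate λ v → does (v ∈? L)

  ∈-elements⁺ : ∀ {S v} → v ∈ₛ S → v ∈ elements S
  ∈-elements⁺ {S} v∈S = ∈-filter⁺ (_∈ₛ? S) (∈-allFin _) v∈S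

  ∈-elements⁻ : ∀ {S v} → v ∈ elements S → v ∈ₛ S
  ∈-elements⁻ {S} v∈ = proj₂ (∈-filter⁻ (_∈ₛ? S) {xs = allFin n} v∈)

  elements-Unique : ∀ S → Unique (elements S)
  elements-Unique S = filter⁺ (_∈ₛ? S) (allFin⁺ n)

  ∈-fromList⁺ : ∀ {L v} → v ∈ L → v ∈ₛ fromList L
  ∈-fromList⁺ {L} {v} v∈L = lookup⇒[]= v _ (trans (lookup∘tabulate _ v) (dec-true (v ∈? L) v∈L))

  ∈-fromList⁻ : ∀ {L v} → v ∈ₛ fromList L → v ∈ L
  ∈-fromList⁻ {L} {v} v∈ with trans (sym (lookup∘tabulate _ v)) ([]=⇒lookup v∈)
  ... | eq with v ∈? L
  ... | yes v∈L = v∈L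

  elements-fromList : ∀ {L} → Unique L → elements (fromList L) ↭ L
  elements-fromList {L} u = Unique-↭ (elements-Unique _) u
    (∈-fromList⁻ ∘ ∈-elements⁻) (∈-elements⁺ ∘ ∈-fromList⁺)

  elements-cover : ∀ S → elements S ++ elements (∁ S) ↭ allFin n
  elements-cover S = ↭-trans
    (++⁺ˡ (elements S) (Unique-↭ (elements-Unique (∁ S)) (filter⁺ ¬∈? (allFin⁺ n))
      (λ v∈ → ∈-filter⁺ ¬∈? (∈-allFin _) (x∈∁p⇒x∉p (∈-elements⁻ v∈)))
      (λ v∈ → ∈-elements⁺ (x∉p⇒x∈∁p (proj₂ (∈-filter⁻ ¬∈? {xs = allFin n} v∈))))))
    (filter-complement (_∈ₛ? S) (allFin n))
    where
    ¬∈? = ¬? ∘ (_∈ₛ? S)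

∣tabulate∣ : ∀ {n} (f : Fin n → Bool) →
  ∣ Vec.tabulate f ∣ ≡ sumOver (allFin n) (λ v → if f v then 1 else 0)
∣tabulate∣ {n} f = trans (go f) (cong sum (sym (map-tabulate {n = n} (λ v → v) (λ v → if f v then 1 else 0))))
  where
  go : ∀ {n} (f : Fin n → Bool) → ∣ Vec.tabulate f ∣ ≡ sum (List.tabulate (λ v → if f v then 1 else 0))
  go {zero} f = refl
  go {suc n} f with f Fin.zero
  ... | true  = cong suc (go (f ∘ Fin.suc))
  ... | false = go (f ∘ Fin.suc)

length-elements : ∀ {n} (S : Subset n) → length (elements S) ≡ ∣ S ∣
length-elements {n} S = trans (length-filter≡ (allFin n))
  (trans (sym (∣tabulate∣ (Vec.lookup S))) (cong ∣_∣ (tabulate∘lookup S)))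
  where
  length-filter≡ : ∀ L → length (filter (_∈ₛ? S) L) ≡ sumOver L (λ v → if Vec.lookup S v then 1 else 0)
  length-filter≡ [] = refl
  length-filter≡ (v ∷ L) with v ∈ₛ? S | Vec.lookup S v in eq
  ... | yes _   | true  = cong suc (length-filter≡ L)
  ... | yes v∈S | false with () ← trans (sym eq) ([]=⇒lookup v∈S)
  ... | no v∉S  | true  = ⊥-elim (v∉S (lookup⇒[]= v S eq))
  ... | no _    | false = length-filter≡ L

∣fromList∣ : ∀ {n} {L : List (Fin n)} → Unique L → ∣ fromList L ∣ ≡ length L
∣fromList∣ {L = L} u = trans (sym (length-elements (fromList L))) (↭-length (elements-fromList u))

-- Mate functions and matchable lists

module _ {n : ℕ} (G : Graph n) where

  private
    V : Set
    V = Fin n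

  -- Each edge is counted at its end of smaller index, so `count` says that `L` has twice as many
  -- vertices as edges, without dividing.
  record Realisation (L : List V) : Set where
    field
      mate      : V → Maybe V
      mateEdge  : ∀ v w → mate v ≡ just w → Edge G v w
      mateSym   : ∀ v w → mate v ≡ just w → mate w ≡ just v
      mateIn    : ∀ v w → mate v ≡ just w → v ∈ L
      covers    : ∀ {v} → v ∈ L → ∃ λ w → mate v ≡ just w
      count     : sumOver L (λ v → lowerEnd G v (mate v)) + sumOver L (λ v → lowerEnd G v (mate v)) ≡ length L

  open Realisation

  lowerEnd-pair : ∀ {u v} → u ≢ v → lowerEnd G u (just v) + lowerEnd G v (just u) ≡ 1
  lowerEnd-pair {u} {v} u≢v with toℕ u <? toℕ v | toℕ v <? toℕ u
  ... | yes u<v | yes v<u = ⊥-elim (ℕ.<-asym u<v v<u)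
  ... | yes _   | no _    = refl
  ... | no _    | yes _   = refl
  ... | no u≮v  | no v≮u  = ⊥-elim (u≢v (toℕ-injective (ℕ.≤-antisym (ℕ.≮⇒≥ v≮u) (ℕ.≮⇒≥ u≮v))))

  private
    link : V → V → (V → Maybe V) → V → Maybe V
    link u v m w with w ≟ u | w ≟ v
    ... | yes _ | _     = just v
    ... | no _  | yes _ = just u
    ... | no _  | no _  = m w

    link-fst : ∀ u v m → link u v m u ≡ just v
    link-fst u v m with u ≟ u | u ≟ v
    ... | yes _ | _ = refl
    ... | no ¬p | _ = ⊥-elim (¬p refl)

    link-snd : ∀ {u v} m → u ≢ v → link u v m v ≡ just u
    link-snd {u} {v} m u≢v with v ≟ u | v ≟ v
    ... | yes eq | _    = ⊥-elim (u≢v (sym eq))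
    ... | no _ | yes _  = refl
    ... | no _ | no ¬p  = ⊥-elim (¬p refl)

    link-other : ∀ {u v w} m → w ≢ u → w ≢ v → link u v m w ≡ m w
    link-other {u} {v} {w} m w≢u w≢v with w ≟ u | w ≟ v
    ... | yes eq | _      = ⊥-elim (w≢u eq)
    ... | no _   | yes eq = ⊥-elim (w≢v eq)
    ... | no _   | no _   = refl

  realise : ∀ {L} → Unique L → Matchable G L → Realisation L
  realise _ empty = record
    { mate = λ _ → nothing ; mateEdge = λ _ _ () ; mateSym = λ _ _ () ; mateIn = λ _ _ ()
    ; covers = λ () ; count = refl }
  realise {X} uX (pair {u} {v} {L} e m p) = record
    { mate = mate′
    ; mateEdge = edge′
    ; mateSym = sym′
    ; mateIn = in′
    ; covers = λ w∈X → covers′ (∈-resp-↭ p w∈X)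
    ; count = count′
    }
    where
    uu : Unique (u ∷ v ∷ L)
    uu = Unique-resp-↭ p uX
    u∉L : u ∉ L
    u∉L = Unique-head uu ∘ there
    v∉L : v ∉ L
    v∉L = Unique-head (Unique-tail uu)
    u≢v : u ≢ v
    u≢v = Edge-irrefl G e
    R = realise (Unique-tail (Unique-tail uu)) m
    mate′ = link u v (mate R)
    to-X : ∀ {w} → w ∈ u ∷ v ∷ L → w ∈ X
    to-X = ∈-resp-↭ (↭-sym p)
    inside : ∀ {w} → w ∈ L → mate′ w ≡ mate R w
    inside w∈L = link-other (mate R) (λ { refl → u∉L w∈L }) (λ { refl → v∉L w∈L })
    edge′ : ∀ a b → mate′ a ≡ just b → Edge G a b
    edge′ a b eq with a ≟ u | a ≟ v
    edge′ a b refl | yes refl | _        = e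
    edge′ a b refl | no _     | yes refl = Edge-sym G e
    edge′ a b eq   | no _     | no _     = mateEdge R a b eq
    sym′ : ∀ a b → mate′ a ≡ just b → mate′ b ≡ just a
    sym′ a b eq with a ≟ u | a ≟ v
    sym′ a b refl | yes refl | _        = link-snd (mate R) u≢v
    sym′ a b refl | no _     | yes refl = link-fst u v (mate R)
    sym′ a b eq   | no _     | no _     = trans (inside (mateIn R b a eq′)) eq′
      where eq′ = mateSym R a b eq
    in′ : ∀ a b → mate′ a ≡ just b → a ∈ X
    in′ a b eq with a ≟ u | a ≟ v
    in′ a b eq | yes refl | _        = to-X (here refl)
    in′ a b eq | no _     | yes refl = to-X (there (here refl))
    in′ a b eq | no _     | no _     = to-X (there (there (mateIn R a b eq)))
    covers′ : ∀ {w} → w ∈ u ∷ v ∷ L → ∃ λ w′ → mate′ w ≡ just w′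
    covers′ (here refl) = v , link-fst u v (mate R)
    covers′ (there (here refl)) = u , link-snd (mate R) u≢v
    covers′ (there (there w∈L)) with w′ , eq ← covers R w∈L = w′ , trans (inside w∈L) eq
    low low′ : V → ℕ
    low w = lowerEnd G w (mate R w)
    low′ w = lowerEnd G w (mate′ w)
    sum≡ : sumOver X low′ ≡ 1 + sumOver L low
    sum≡ = begin
      sumOver X low′                     ≡⟨ sumOver-↭ low′ p ⟩
      low′ u + (low′ v + sumOver L low′) ≡⟨ sym (ℕ.+-assoc (low′ u) (low′ v) _) ⟩
      (low′ u + low′ v) + sumOver L low′ ≡⟨ cong₂ _+_
        (trans (cong₂ (λ a b → lowerEnd G u a + lowerEnd G v b) (link-fst u v (mate R)) (link-snd (mate R) u≢v))
               (lowerEnd-pair u≢v))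
        (sumOver-cong L λ {w} w∈L → cong (lowerEnd G w) (inside w∈L)) ⟩
      1 + sumOver L low                  ∎
      where open ≡-Reasoning
    count′ : sumOver X low′ + sumOver X low′ ≡ length X
    count′ = begin
      sumOver X low′ + sumOver X low′             ≡⟨ cong₂ _+_ sum≡ sum≡ ⟩
      (1 + sumOver L low) + (1 + sumOver L low)   ≡⟨ cong suc (ℕ.+-suc _ _) ⟩
      2 + (sumOver L low + sumOver L low)         ≡⟨ cong (2 +_) (count R) ⟩
      2 + length L                                ≡⟨ sym (↭-length p) ⟩
      length X                                    ∎
      where open ≡-Reasoning

  Matchable⇒HasPerfectMatchingIn : ∀ {L U} → Unique L → Matchable G L →
    (∀ {v} → v ∈ L → v ∈ₛ U) → (∀ {v} → v ∈ₛ U → v ∈ L) → HasPerfectMatchingIn G U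
  Matchable⇒HasPerfectMatchingIn u m to from =
    record { mate = mate R ; mateEdge = mateEdge R ; mateSym = mateSym R
           ; mateIn = λ v w eq → to (mateIn R v w eq) } ,
    λ v v∈U → covers R (from v∈U)
    where R = realise u m

  -- The head and its mate are split off repeatedly. Only closure of `L` under mates is asked for,
  -- so that a perfect matching of `G` can be restricted to a part.
  closed⇒Matchable : ∀ {U} (M : MatchingIn G U) {L} → Unique L →
    (∀ {v} → v ∈ L → ∃ λ w → w ∈ L × MatchingIn.mate M v ≡ just w) → Matchable G L
  closed⇒Matchable M {L} = go (length L) ℕ.≤-refl
    where
    open MatchingIn M using () renaming (mate to μ; mateEdge to μ-edge; mateSym to μ-sym)
    go : ∀ f {L} → length L ≤ f → Unique L →
      (∀ {v} → v ∈ L → ∃ λ w → w ∈ L × μ v ≡ just w) → Matchable G L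
    go f {[]} _ _ _ = empty
    go (suc f) {u ∷ L} (s≤s le) uL closed with closed (here refl)
    ... | _ , here refl , eq = ⊥-elim (Edge-irrefl G (μ-edge u u eq) refl)
    ... | v , there v∈L , eq with L′ , p ← ∈⇒↭ v∈L =
      pair (μ-edge u v eq)
        (go f (ℕ.≤-trans (ℕ.n≤1+n _) (subst (_≤ f) (↭-length p) le)) (Unique-tail uvL′) closed′)
        (prep u p)
      where
      uvL′ : Unique (v ∷ L′)
      uvL′ = Unique-resp-↭ p (Unique-tail uL)
      closed′ : ∀ {x} → x ∈ L′ → ∃ λ w → w ∈ L′ × μ x ≡ just w
      -- Were the mate of `x` one of `u` and `v`, then `x` would be the other one, which no longer
      -- occurs in `L′`.
      closed′ {x} x∈L′ with closed (there (∈-resp-↭ (↭-sym p) (there x∈L′)))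
      ... | w , here refl , eqx = ⊥-elim (Unique-head uvL′
        (subst (_∈ L′) (just-injective (trans (sym (μ-sym x u eqx)) eq)) x∈L′))
      ... | w , there w∈L , eqx with ∈-resp-↭ p w∈L
      ... | there w∈L′ = w , w∈L′ , eqx
      ... | here refl = ⊥-elim (Unique-head uL (∈-resp-↭ (↭-sym p) (there
        (subst (_∈ L′) (just-injective (trans (sym (μ-sym x v eqx)) (μ-sym u v eq))) x∈L′))))

  HasPerfectMatchingIn⇒Matchable : ∀ {U} → HasPerfectMatchingIn G U → Matchable G (elements U)
  HasPerfectMatchingIn⇒Matchable {U} (M , perfect) = closed⇒Matchable M (elements-Unique U) λ {v} v∈ →
    let w , eq = perfect v (∈-elements⁻ v∈)
    in w , ∈-elements⁺ (mateIn′ w v (mateSym′ v w eq)) , eq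
    where
    open MatchingIn M using () renaming (mateIn to mateIn′; mateSym to mateSym′)

-- Consequences of extendability

module _ {n : ℕ} (G : Graph n) where

  private
    V : Set
    V = Fin n


  -- The k-matching of `X` extends to a perfect matching that agrees with it on `X`, so the mates of
  -- vertices of `Y` stay in `Y`.
  extend-complement : ∀ {k X Y} → Extendable G k → X ++ Y ↭ allFin n → length X ≡ k + k →
    Matchable G X → Matchable G Y
  extend-complement {k} {X} {Y} (_ , _ , extend) cover len m = complement (extend M size≡k)
    where
    uXY : Unique (X ++ Y)
    uXY = Unique-resp-↭ (↭-sym cover) (allFin⁺ n)
    uY : Unique Y
    uY = Unique-++ˡ Y (Unique-resp-↭ (++-comm X Y) uXY)
    R = realise G (Unique-++ˡ X uXY) m
    open Realisation R
    M : Matching G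
    M = record { mate = mate ; mateEdge = mateEdge ; mateSym = mateSym ; mateIn = λ _ _ _ → ∈⊤ }
    low : V → ℕ
    low v = lowerEnd G v (mate v)
    -- `size` sums over all vertices. Those of `Y` contribute nothing, so `count` yields size `k`.
    unmated : ∀ {v} → v ∈ Y → low v ≡ 0
    unmated {v} v∈Y with mate v in eq
    ... | nothing = refl
    ... | just w = ⊥-elim (Unique-++-disjoint X uXY (mateIn v w eq) v∈Y)
    size≡ : size G M ≡ sumOver X low
    size≡ = begin
      sumOver (allFin n) low         ≡⟨ sumOver-↭ low (↭-sym cover) ⟩
      sumOver (X ++ Y) low           ≡⟨ sumOver-++ X Y low ⟩
      sumOver X low + sumOver Y low  ≡⟨ cong (sumOver X low +_) (trans (sumOver-cong Y unmated) (sumOver-0 Y)) ⟩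
      sumOver X low + 0              ≡⟨ ℕ.+-identityʳ _ ⟩
      sumOver X low                  ∎
      where open ≡-Reasoning
    size≡k : size G M ≡ k
    size≡k = +-self-injective (trans (cong₂ _+_ size≡ size≡) (trans count len))
    complement : (∃ λ M′ → PerfectIn G M′ × _⊆M_ G M M′) → Matchable G Y
    complement (M′ , perfect , M⊆M′) = closed⇒Matchable G M′ uY closed
      where
      open MatchingIn M′ using () renaming (mate to μ; mateSym to μ-sym)
      closed : ∀ {v} → v ∈ Y → ∃ λ w → w ∈ Y × μ v ≡ just w
      closed {v} v∈Y with w , eq ← perfect v ∈⊤ with ∈-++⁻ X (∈-resp-↭ (↭-sym cover) (∈-allFin w))
      ... | inj₂ w∈Y = w , w∈Y , eq
      ... | inj₁ w∈X with w′ , eq′ ← covers w∈X =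
        ⊥-elim (Unique-++-disjoint X uXY
          (mateIn v w (mateSym w v (trans eq′ (trans (sym (M⊆M′ w w′ eq′)) (μ-sym v w eq))))) v∈Y)

  extendable⇒Matchable : ∀ {k} → Extendable G k → Matchable G (allFin n)
  extendable⇒Matchable (_ , (M , size≡) , extend) with M′ , perfect , _ ← extend M size≡ =
    closed⇒Matchable G M′ (allFin⁺ n) λ {v} _ → let w , eq = perfect v ∈⊤ in w , ∈-allFin w , eq

-- From an unmatchable half to components on both sides

record Structure {n : ℕ} (G : Graph n) (N : ℕ) : Set where
  field
    T W         : List (Fin n)
    cover       : T ++ W ↭ allFin n
    card₁       : length T ≡ N
    card₂       : length W ≡ N
    components₁ : TwoComponents G T
    components₂ : TwoComponents G W

module _ {n : ℕ} (G : Graph n) (N : ℕ)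
  (exchangeable : ∀ {X Y} → X ++ Y ↭ allFin n → length X ≡ N → Matchable G X → Matchable G Y)
  (order : N + N ≡ n) (deg : ∀ v → suc N ≤ degree G v)
  where
  open Deficiency G N exchangeable order deg

  -- Moves from an unmatchable set to a matchable one by replacing one vertex at a time; the
  -- last unmatchable set on the way has deficiency two.
  deficient-between : ∀ S R {C Z} → (C ++ S) ++ (R ++ Z) ↭ allFin n → length S ≡ length R →
    length (C ++ S) ≡ N → Matchable G (C ++ R) → ¬ Matchable G (C ++ S) → ∃₂ Deficient
  deficient-between [] [] _ _ _ m ¬m = ⊥-elim (¬m m)
  deficient-between (s ∷ S) (r ∷ R) {C} {Z} cover len len-T m ¬m
    with Matchable? G (r ∷ C ++ S)
  -- Replacing `s` by `r` first makes the set matchable here. Without `r` and its partner `v`, the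
  -- matching leaves exactly `s` and `v` of the previous set missed.
  ... | yes m′ with v , L , _ , mL , p ← partner G m′ (here refl) =
    C ++ s ∷ S , r ∷ R ++ Z , record
      { cover = cover ; card = len-T ; unmatchable = ¬m
      ; pairing = s , v , L , ↭-trans (shift s C S) (prep s (drop-∷ p)) , mL }
  ... | no ¬m′ = deficient-between S R {r ∷ C} {s ∷ Z}
    (↭-trans (solve 6 (λ r c s t u z → (r ⊕ c ⊕ t) ⊕ (u ⊕ s ⊕ z) ⊜ (c ⊕ s ⊕ t) ⊕ (r ⊕ u ⊕ z)) ↭-refl
      [ r ] C [ s ] S R Z) cover)
    (ℕ.suc-injective len)
    (trans (sym (↭-length (shift s C S))) len-T)
    (Matchable-resp-↭ G (shift r C R) m) ¬m′

  deficient-exists : ∀ {X Y P Q} → X ++ Y ↭ allFin n → P ++ Q ↭ allFin n →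
    length X ≡ N → length P ≡ N → Matchable G P → ¬ Matchable G X → ∃₂ Deficient
  deficient-exists {X} {Y} {P} {Q} cX cP lX lP mP ¬mX
    with C , S , R , Z , a , b , c , _ ← common-refinement (↭-trans cX (↭-sym cP)) =
    deficient-between S R (↭-trans (↭-sym (++⁺ a b)) cX)
      (ℕ.+-cancelˡ-≡ (length C) _ _ (begin
        length C + length S ≡⟨ sym (length-++ C) ⟩
        length (C ++ S)     ≡⟨ lCS ⟩
        N                   ≡⟨ sym lP ⟩
        length P            ≡⟨ ↭-length c ⟩
        length (C ++ R)     ≡⟨ length-++ C ⟩
        length C + length R ∎))
      lCS (Matchable-resp-↭ G c mP) (¬mX ∘ Matchable-resp-↭ G (↭-sym a))
    where
    open ≡-Reasoning
    lCS = trans (sym (↭-length a)) lX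

  deficient⇒structure : ∃₂ Deficient → Structure G N
  deficient⇒structure (T , W , D) = record
    { T = T ; W = W ; cover = cover D ; card₁ = card D ; card₂ = card D′
    ; components₁ = components D ; components₂ = components D′ }
    where
    open Deficient
    D′ = Deficient-sym D
    components : ∀ {T W} → Deficient T W → TwoComponents G T
    components {T} D = two-components G
      (Unique-++ˡ T (Unique-resp-↭ (↭-sym (cover D)) (allFin⁺ n)))
      (unmatchable D) (all-missable D) (proj₂ (proj₂ (pairing D)))

-- Components and obstructions for subsets

module _ {n : ℕ} (G : Graph n) where

  FactorCriticalList⇒FactorCriticalIn : ∀ {C} → Unique C → FactorCriticalList G C →
    FactorCriticalIn G (fromList C)
  FactorCriticalList⇒FactorCriticalIn {C} uC fc v v∈ with A , p , m ← fc (∈-fromList⁻ v∈) =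
    Matchable⇒HasPerfectMatchingIn G (Unique-tail uvA) m
      (λ {w} w∈A → x∈p∧x≢y⇒x∈p-y (∈-fromList⁺ (∈-resp-↭ (↭-sym p) (there w∈A)))
        λ { refl → Unique-head uvA w∈A })
      λ {w} w∈ → tail w∈ (∈-resp-↭ p (∈-fromList⁻ (p─q⊆p _ ⁅ v ⁆ w∈)))
    where
    uvA : Unique (v ∷ A)
    uvA = Unique-resp-↭ p uC
    tail : ∀ {w} → w ∈ₛ fromList C - v → w ∈ v ∷ A → w ∈ A
    tail w∈ (here refl) = ⊥-elim (∈─⇒∉ {p = fromList C} w∈ (x∈⁅x⁆ v))
    tail _ (there w∈A) = w∈A

  -- Walks grow at their start, so the target `v` is fixed and reaching it is the property
  -- propagated along edges.
  FactorCriticalList⇒ConnectedIn : ∀ {C} → FactorCriticalList G C → ConnectedIn G (fromList C)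
  FactorCriticalList⇒ConnectedIn fc u v u∈ v∈ =
    factorCritical-connected G {Q = λ w → ReachIn G _ w v} fc
      (λ _ w∈C e reach → step (∈-fromList⁺ w∈C) (Edge-sym G e) reach)
      (∈-fromList⁻ v∈) (here v∈) (∈-fromList⁻ u∈)

  TwoComponents⇒TwoFCComponents : ∀ {T W U} → T ++ W ↭ allFin n → TwoComponents G T →
    (∀ v → suc (length W) ≤ degree G v) →
    (∀ {v} → v ∈ T → v ∈ₛ U) → (∀ {v} → v ∈ₛ U → v ∈ T) → TwoFCComponents G U
  TwoComponents⇒TwoFCComponents {T} {W} {U} cover S deg to from =
    fromList C₁ , fromList C₂ ,
    ⊆-antisym
      (λ v∈ → to (∈-resp-↭ (↭-sym split) (union⁻ (x∈p∪q⁻ _ _ v∈))))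
      (λ v∈ → x∈p∪q⁺ (union⁺ (∈-++⁻ C₁ (∈-resp-↭ split (from v∈))))) ,
    Empty-unique (λ (v , v∈) → let v∈₁ , v∈₂ = x∈p∩q⁻ _ _ v∈ in
      Unique-++-disjoint C₁ u₁₂ (∈-fromList⁻ v∈₁) (∈-fromList⁻ v∈₂)) ,
    FactorCriticalList⇒ConnectedIn critical₁ , FactorCriticalList⇒ConnectedIn critical₂ ,
    (λ u v u∈ v∈ → separated (∈-fromList⁻ u∈) (∈-fromList⁻ v∈)) ,
    subst (3 ≤_) (sym (∣fromList∣ u₁)) (three S) ,
    subst (3 ≤_) (sym (∣fromList∣ u₂)) (three (TwoComponents-swap G S)) ,
    FactorCriticalList⇒FactorCriticalIn u₁ critical₁ ,
    FactorCriticalList⇒FactorCriticalIn u₂ critical₂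
    where
    open TwoComponents S
    u₁₂ : Unique (C₁ ++ C₂)
    u₁₂ = Unique-resp-↭ split (Unique-++ˡ T (Unique-resp-↭ (↭-sym cover) (allFin⁺ n)))
    u₁ : Unique C₁
    u₁ = Unique-++ˡ C₁ u₁₂
    u₂ : Unique C₂
    u₂ = Unique-++ˡ C₂ (Unique-resp-↭ (++-comm C₁ C₂) u₁₂)
    union⁻ : ∀ {v} → v ∈ₛ fromList C₁ ⊎ v ∈ₛ fromList C₂ → v ∈ C₁ ++ C₂
    union⁻ (inj₁ v∈) = ∈-++⁺ˡ (∈-fromList⁻ {L = C₁} v∈)
    union⁻ (inj₂ v∈) = ∈-++⁺ʳ C₁ (∈-fromList⁻ v∈)
    union⁺ : ∀ {v} → v ∈ C₁ ⊎ v ∈ C₂ → v ∈ₛ fromList C₁ ⊎ v ∈ₛ fromList C₂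
    union⁺ (inj₁ v∈) = inj₁ (∈-fromList⁺ v∈)
    union⁺ (inj₂ v∈) = inj₂ (∈-fromList⁺ v∈)
    -- The degree bounds force at least 2 vertices, and the order is odd.
    three : (S : TwoComponents G T) → 3 ≤ length (TwoComponents.C₁ S)
    three S with v , v∈ ← TwoComponents.inhabited₁ S
            with factorCritical-odd G (TwoComponents.critical₁ S) v∈
               | ℕ.+-cancelʳ-≤ (length W) 2 _ (ℕ.≤-trans (s≤s (deg v)) (degree-< G cover S v∈))
    ... | zero  , eq | two rewrite eq with s≤s () ← two
    ... | suc j , eq | _ rewrite eq | ℕ.+-suc j j = s≤s (s≤s (s≤s z≤n))

  -- No edge inside `U` leaves `C₁`, so a matching of `U` restricts to one of `C₁`. But `C₁` minus a
  -- vertex is matchable, so `C₁` has odd order.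
  TwoFCComponents⇒¬Matchable : ∀ {U} → TwoFCComponents G U → ¬ Matchable G (elements U)
  TwoFCComponents⇒¬Matchable {U}
    (C₁ , C₂ , ∪≡ , _ , _ , _ , separated , 3≤ , _ , critical , _) m =
    contradiction (elements C₁) refl
    where
    m₁ : Matchable G (filter (_∈ₛ? C₁) (elements U))
    m₁ = Matchable-filter G (_∈ₛ? C₁) m closed
      where
      closed : ∀ {u v} → u ∈ elements U → v ∈ elements U → Edge G u v → u ∈ₛ C₁ → v ∈ₛ C₁
      closed {u} {v} _ v∈U e u∈C₁ with x∈p∪q⁻ C₁ C₂ (subst (v ∈ₛ_) (sym ∪≡) (∈-elements⁻ v∈U))
      ... | inj₁ v∈C₁ = v∈C₁
      ... | inj₂ v∈C₂ = ⊥-elim (separated u v u∈C₁ v∈C₂ e)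
    C₁↭ : elements C₁ ↭ filter (_∈ₛ? C₁) (elements U)
    C₁↭ = Unique-↭ (elements-Unique C₁) (filter⁺ (_∈ₛ? C₁) (elements-Unique U))
      (λ {v} v∈ → ∈-filter⁺ (_∈ₛ? C₁)
        (∈-elements⁺ (subst (v ∈ₛ_) ∪≡ (x∈p∪q⁺ (inj₁ (∈-elements⁻ v∈))))) (∈-elements⁻ v∈))
      (λ v∈ → ∈-elements⁺ (proj₂ (∈-filter⁻ (_∈ₛ? C₁) {xs = elements U} v∈)))
    contradiction : ∀ L → elements C₁ ≡ L → ⊥
    -- The lower bound on the size supplies a vertex of `C₁`.
    contradiction [] eq with () ← subst (3 ≤_) (trans (sym (length-elements C₁)) (cong length eq)) 3≤
    contradiction (v ∷ L) eq
      with i , even ← Matchable-even G (Matchable-resp-↭ G (↭-sym C₁↭) m₁)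
      with j , odd ← Matchable-even G (HasPerfectMatchingIn⇒Matchable G
             (critical v (∈-elements⁻ (subst (v ∈_) (sym eq) (here refl))))) =
      odd≢even j i (trans (cong suc (sym odd)) (trans (↭-length v∷↭) even))
      where
      v∈C₁ : v ∈ₛ C₁
      v∈C₁ = ∈-elements⁻ (subst (v ∈_) (sym eq) (here refl))
      v∉ : v ∉ elements (C₁ - v)
      v∉ v∈ = ∈─⇒∉ {p = C₁} (∈-elements⁻ v∈) (x∈⁅x⁆ v)
      v∷↭ : v ∷ elements (C₁ - v) ↭ elements C₁
      v∷↭ = Unique-↭ (All.tabulate (λ { w∈ refl → v∉ w∈ }) ∷ elements-Unique (C₁ - v)) (elements-Unique C₁)
        (λ { (here refl) → ∈-elements⁺ v∈C₁
           ; (there w∈) → ∈-elements⁺ (p─q⊆p C₁ ⁅ v ⁆ (∈-elements⁻ w∈)) })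
        back
        where
        back : ∀ {w} → w ∈ elements C₁ → w ∈ v ∷ elements (C₁ - v)
        back {w} w∈ with w ≟ v
        ... | yes refl = here refl
        ... | no w≢v = there (∈-elements⁺ (x∈p∧x≢y⇒x∈p-y (∈-elements⁻ w∈) w≢v))

  -- Deleting all neighbours of `v` leaves `v` isolated.
  neighbourhood-obstructs : ∀ v → ¬ HasPerfectMatchingIn G (∁ (Vec.tabulate (Graph.adj G v)))
  neighbourhood-obstructs v (M , perfect)
    with w , eq ← perfect v (x∉p⇒x∈∁p λ v∈ →
      Edge-irrefl G (trans (sym (lookup∘tabulate (Graph.adj G v) v)) ([]=⇒lookup v∈)) refl) =
    x∈∁p⇒x∉p (MatchingIn.mateIn M w v (MatchingIn.mateSym M v w eq))
      (lookup⇒[]= w _ (trans (lookup∘tabulate _ w) (MatchingIn.mateEdge M v w eq)))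

-- The three ranges of the minimum degree

module _ {k : ℕ} (G : Graph (4 * k)) (extendable : Extendable G k) where

  private
    2*k≡k+k : 2 * k ≡ k + k
    2*k≡k+k = cong (k +_) (ℕ.+-identityʳ k)

    order : 2 * k + 2 * k ≡ 4 * k
    order = sym (ℕ.*-distribʳ-+ k 2 2)

    exchangeable : ∀ {X Y} → X ++ Y ↭ allFin (4 * k) → length X ≡ 2 * k →
      Matchable G X → Matchable G Y
    exchangeable cover len = extend-complement G extendable cover (trans len 2*k≡k+k)

  unmatchable⇒structure : (deg : ∀ v → suc (2 * k) ≤ degree G v) → ∀ {S} → ∣ S ∣ ≡ 2 * k →
    ¬ Matchable G (elements (∁ S)) → Structure G (2 * k)
  unmatchable⇒structure deg {S} card ¬m
    with X , Y , p , len , m ← Matchable-prefix G (extendable⇒Matchable G extendable) k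
           (subst₂ _≤_ 2*k≡k+k (trans order (sym (length-tabulate _))) (ℕ.m≤m+n (2 * k) (2 * k))) =
    deficient⇒structure G (2 * k) exchangeable order deg
      (deficient-exists G (2 * k) exchangeable order deg cover (↭-sym p) len∁
        (trans len (sym 2*k≡k+k)) m ¬m)
    where
    cover : elements (∁ S) ++ elements S ↭ allFin (4 * k)
    cover = ↭-trans (++-comm (elements (∁ S)) _) (elements-cover S)
    len∁ : length (elements (∁ S)) ≡ 2 * k
    len∁ = complement-size order (elements S) _ (elements-cover S)
      (trans (length-elements S) card)

theorem7 : (k : ℕ) → 1 ≤ k → (G : Graph (4 * k)) → Connected G → ¬ Bipartite G →
    Extendable G k → (d : ℕ) → MinDegree G d →
    (3 * k ≤ d → FactorCritical G (2 * k))
    × (d ≡ 2 * k → ¬ FactorCritical G (2 * k))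
    × (2 * k + 1 ≤ d → d ≤ 3 * k Data.Nat.∸ 1 →
    ((¬ FactorCritical G (2 * k)) ⇔
    (∃ λ (V₁ : Subset (4 * k)) → (∣ V₁ ∣ ≡ 2 * k) × (∣ ∁ V₁ ∣ ≡ 2 * k)
    × TwoFCComponents G V₁ × TwoFCComponents G (∁ V₁))))
theorem7 k 1≤k G _ _ extendable d (d≤degree , v , degree≡d) =
  part₁ , part₂ , λ 2k<d _ → mk⇔ (partition 2k<d) obstructed
  where
  perfect : ∀ S → Matchable G (elements (∁ S)) → HasPerfectMatchingIn G (∁ S)
  perfect S m = Matchable⇒HasPerfectMatchingIn G (elements-Unique (∁ S)) m ∈-elements⁻ ∈-elements⁺

  part₁ : 3 * k ≤ d → FactorCritical G (2 * k)
  part₁ 3k≤d S card = perfect S (decidable-stable (Matchable? G _) λ ¬m →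
    too-small (unmatchable⇒structure G extendable deg {S} card ¬m))
    where
    deg : ∀ v → suc (2 * k) ≤ degree G v
    -- From 1 ≤ k follows 2k + 1 ≤ 3k.
    deg v = ℕ.≤-trans (ℕ.+-monoˡ-≤ (2 * k) 1≤k) (ℕ.≤-trans 3k≤d (d≤degree v))
    large : ∀ {c x} → x < c + 2 * k → 3 * k ≤ x → k < c
    large {c} x< 3k≤ = ℕ.+-cancelʳ-≤ (2 * k) _ _ (ℕ.≤-trans (s≤s 3k≤) x<)
    -- Minimum degree 3k forces more than `k` vertices into each component of `T`, which has only
    -- 2k.
    too-small : ¬ Structure G (2 * k)
    too-small S = ℕ.<-irrefl refl (begin-strict
        k + k                        <⟨ ℕ.+-mono-< (component components₁) (component (TwoComponents-swap G components₁)) ⟩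
        length C₁ + length C₂        ≡⟨ sym (length-++ C₁) ⟩
        length (C₁ ++ C₂)            ≡⟨ sym (↭-length split) ⟩
        length T                     ≡⟨ card₁ ⟩
        2 * k                        ≡⟨ cong (k +_) (ℕ.+-identityʳ k) ⟩
        k + k                        ∎)
      where
      open ℕ.≤-Reasoning
      open Structure S
      open TwoComponents components₁ using (C₁; C₂; split)
      component : (S : TwoComponents G T) → k < length (TwoComponents.C₁ S)
      component S with v , v∈ ← TwoComponents.inhabited₁ S =
        large (subst (λ l → degree G v < length (TwoComponents.C₁ S) + l) card₂ (degree-< G cover S v∈))
          (ℕ.≤-trans 3k≤d (d≤degree v))

  part₂ : d ≡ 2 * k → ¬ FactorCritical G (2 * k)
  -- `v` attains the minimum degree, so its neighbourhood has exactly 2k vertices.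
  part₂ d≡2k fc = neighbourhood-obstructs G v
    (fc _ (trans (∣tabulate∣ (Graph.adj G v)) (trans degree≡d d≡2k)))

  Partition : Set
  Partition = ∃ λ V₁ → (∣ V₁ ∣ ≡ 2 * k) × (∣ ∁ V₁ ∣ ≡ 2 * k)
    × TwoFCComponents G V₁ × TwoFCComponents G (∁ V₁)

  structure⇒partition : (∀ v → suc (2 * k) ≤ degree G v) → Structure G (2 * k) → Partition
  structure⇒partition deg structure = fromList T ,
    trans (∣fromList∣ uT) card₁ ,
    (begin
      ∣ ∁ (fromList T) ∣         ≡⟨ ∣∁p∣≡n∸∣p∣ (fromList T) ⟩
      4 * k ∸ ∣ fromList T ∣     ≡⟨ cong₂ _∸_ (ℕ.*-distribʳ-+ k 2 2) (trans (∣fromList∣ uT) card₁) ⟩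
      2 * k + 2 * k ∸ 2 * k      ≡⟨ ℕ.m+n∸n≡m (2 * k) (2 * k) ⟩
      2 * k                      ∎) ,
    TwoComponents⇒TwoFCComponents G cover components₁ (bound W card₂) ∈-fromList⁺ ∈-fromList⁻ ,
    TwoComponents⇒TwoFCComponents G (↭-trans (++-comm W T) cover) components₂ (bound T card₁)
      (λ v∈W → x∉p⇒x∈∁p λ v∈ → Unique-++-disjoint T uTW (∈-fromList⁻ v∈) v∈W)
      λ {v} v∈ → right (x∈∁p⇒x∉p v∈) (∈-++⁻ T (∈-resp-↭ (↭-sym cover) (∈-allFin v)))
    where
    open ≡-Reasoning
    open Structure structure
    uTW : Unique (T ++ W)
    uTW = Unique-resp-↭ (↭-sym cover) (allFin⁺ (4 * k))
    uT : Unique T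
    uT = Unique-++ˡ T uTW
    bound : ∀ (L : List (Fin (4 * k))) → length L ≡ 2 * k → ∀ v → suc (length L) ≤ degree G v
    bound L eq v = subst (λ l → suc l ≤ degree G v) (sym eq) (deg v)
    right : ∀ {v} → v ∉ₛ fromList T → v ∈ T ⊎ v ∈ W → v ∈ W
    right v∉ (inj₁ v∈T) = ⊥-elim (v∉ (∈-fromList⁺ v∈T))
    right _ (inj₂ v∈W) = v∈W

  partition : 2 * k + 1 ≤ d → ¬ FactorCritical G (2 * k) → Partition
  partition 2k<d ¬fc
    -- A finite search turns the negated universal statement into an explicit bad set.
    with anySubset? (λ S → (∣ S ∣ ℕ.≟ 2 * k) ×-dec ¬? (Matchable? G (elements (∁ S))))
  ... | no none = ⊥-elim (¬fc λ S card → perfect S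
        (decidable-stable (Matchable? G _) λ ¬m → none (S , card , ¬m)))
  ... | yes (S , card , ¬m) =
    structure⇒partition deg (unmatchable⇒structure G extendable deg {S} card ¬m)
    where
    deg : ∀ v → suc (2 * k) ≤ degree G v
    deg v = ℕ.≤-trans (subst (_≤ d) (ℕ.+-comm (2 * k) 1) 2k<d) (d≤degree v)

  obstructed : Partition → ¬ FactorCritical G (2 * k)
  obstructed (V₁ , card , _ , _ , two) fc =
    TwoFCComponents⇒¬Matchable G two (HasPerfectMatchingIn⇒Matchable G (fc V₁ card))
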